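{- Let $W_n$ be the Coxeter group of type $B_n$ with $S=\{s_0,s_1,\dots,s_{n-1}\}$. Fix $J\subset S$ of size $m$, let $k=n-m$, and let $W_k$ be the Weyl group of type $B_k$, acting on $Y_k=\{ -k,\dots,-1,0,1,\dots,k\}$. (1) If $p=p'.p''$ is a reduced composition of core cosets in $W_n$ (for $\mathbb{S}q$ landing in $W_k$, i.e. for cosets whose indexing subsets have size $m$), then $\mathbb{S}q(p)=\mathbb{S}q(p').\mathbb{S}q(p'')$ is a reduced composition in $W_k$ (i.e. the lengths add). (2) The map $\mathbb{S}q$ induces a bijection $$\mathbb{S}q^J\colon\{(I,p)\mid I\subset S,\ p\text{ is a core }(I,J)\text{ -coset}\}\to W_k,$$ which restricts to a bijection between atomic $(I,J)$-cosets (as $I$ varies) and simple reflections of $W_k$. (3) Consequently, for any core $(I,J)$-coset $p$, the map $(p_1,\dots,p_d)\mapsto(\mathbb{S}q(p_1),\dots,\mathbb{S}q(p_d))$ sends atomic reduced expressions for $p$ bijectively to ordinary reduced expressions for $\mathbb{S}q(p)$.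
   Context: $W_n$ has simple reflections $s_0,\dots,s_{n-1}$ with $m_{s_0s_1}=4$, $m_{s_is_{i+1}}=3$ for $i\ge1$, and other pairs commuting. It is viewed as the group of permutations $\sigma$ of $X=\{ -n,\dots,-1,0,1,\dots,n\}$ with $\sigma(-i)=-\sigma(i)$, where $s_0=(-1\ 1)$ and $s_i=(i\ i{+}1)(-i\ { -i}{ - }1)$ for $i>0$. Similarly $W_k$ acts on $Y_k$. Write $W=W_n$ with length $\ell$. For $I\subset S$, $W_I$ is the parabolic subgroup, $w_I$ its longest element, $\ell(I)=\ell(w_I)$. An $(I,J)$-coset is an element $p\in W_I\backslash W/W_J$ (with $(I,J)$ part of the data), with Bruhat-maximal element $\overline p$ and Bruhat-minimal element $\underline p$. It is a core coset if $I=\underline pJ\underline p^{ -1}$ (so $\#I=\#J$). Composition: let $*$ be the $0$-Hecke (star) product on $W$ ($s*w=sw$ if $\ell(sw)>\ell(w)$, else $s*w=w$). For an $(I,J)$-coset $p$ and a $(J,K)$-coset $q$, $p*q=W_I(\overline p*\overline q)W_K$, and $\overline{p*q}=\overline p*\overline q$. It is reduced, written $p.q$, if $\overline p*\overline q=(\overline pw_J^{ -1})\overline q$ with $\ell(\overline p*\overline q)=\ell(\overline p)-\ell(J)+\ell(\overline q)$. A longer composition is reduced if each successive binary composition is. In a Coxeter group, $xy=x.y$ means $\ell(xy)=\ell(x)+\ell(y)$. Atomic coset: for $M\subset S$, $s\in M$, $t=w_Msw_M$, the $(M\setminus\{s\},M\setminus\{t\})$-coset containing $w_M$. An atomic reduced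 expression for a core coset $p$ is a sequence $(p_1,\dots,p_d)$ of composable atomic cosets whose composition is reduced and equals $p$ (the empty sequence is allowed for the identity coset). Squashing: for $J\subset S$, let $\sim_J$ be the equivalence relation on $X$ generated by $j\sim_J j+1$ and $-j\sim_J -j-1$ whenever $s_j\in J$. With $m=\#J$ and $k=n-m$, the classes are contiguous and are labeled in order $C_{ -k}^{(J)}<\dots<C_{ -1}^{(J)}<C_0^{(J)}<C_1^{(J)}<\dots<C_k^{(J)}$ with $0\in C_0^{(J)}$ and $C_{ -c}^{(J)}=-C_c^{(J)}$; so $X/{\sim_J}$ is identified with $Y_k$. For $I,J$ of size $m$, an element $y\in W$ is a block permutation relative to $I$ and $J$ if it sends each class $C_c^{(J)}$ by an order-preserving bijection onto some class $C_{c'}^{(I)}$; then $\mathbb{S}q(y)$ is the induced permutation $c\mapsto c'$ of $Y_k$, which lies in $W_k$. For a core $(I,J)$-coset $p$, $\underline p$ is a block permutation relative to $I$ and $J$, and $\mathbb{S}q(p):=\mathbb{S}q(\underline p)$. -}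

module Defs where

open import Data.Bool using (if_then_else_)
open import Data.Fin using (Fin; zero; suc; toℕ)
open import Data.Fin.Properties using (toℕ<n)
open import Data.Fin.Subset using (Subset; _∈_; _-_; ∣_∣)
open import Data.Integer as ℤ using (ℤ; +_; -[1+_])
import Data.Integer.Properties as ℤ
open import Data.List using (List; []; _∷_; foldr; length)
open import Data.List.Relation.Unary.All using (All)
open import Data.Nat using (ℕ; suc; z≤n; s≤s; _+_; _≤_; _<_)
open import Data.Nat.Properties using (<⇒≤)
import Data.Product as Product
open import Data.Product using (Σ; Σ-syntax; ∃-syntax; ∃₂; _×_; proj₁)
open import Function using (_↔_; _∘_; _on_; Inverse; mk↔ₛ′)
open import Function.Construct.Composition using (_↔-∘_)
open import Function.Construct.Identity using (↔-id)
open import Function.Construct.Symmetry using (↔-sym)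
open import Function.Structures using (IsBijection)
open import Relation.Binary using (Rel)
open import Relation.Binary.Construct.Closure.Equivalence using (EqClosure)
open import Relation.Binary.PropositionalEquality
  using (_≡_; _≢_; refl; sym; trans; cong; subst)
open import Relation.Nullary using (¬_; yes; no; does)
open import Relation.Nullary.Decidable using (dec-true; dec-false)
open import Level using (0ℓ)

private
  variable
    n k m : ℕ

------------------------------------------------------------------------
-- The set {-n, …, n}

-- Both X (for n) and Y_k (for k) are instances of this family.
record X (n : ℕ) : Set where
  constructor mkX
  field
    val    : ℤ
    .bound : ℤ.∣ val ∣ ≤ n
open X public using (val)

val-injective : {x y : X n} → val x ≡ val y → x ≡ y
val-injective refl = refl

pt : (i : ℕ) → .(i ≤ n) → X n
pt i i≤n = mkX (+ i) i≤n

neg : X n → X n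
neg (mkX z b) = mkX (ℤ.- z) (subst (_≤ _) (sym (ℤ.∣-i∣≡∣i∣ z)) b)

------------------------------------------------------------------------
-- Transpositions of {-n, …, n}

swap : X n → X n → X n → X n
swap a b x = if does (val x ℤ.≟ val a) then b else if does (val x ℤ.≟ val b) then a else x

private
  neg-involutive : (x : X n) → neg (neg x) ≡ x
  neg-involutive x = val-injective (ℤ.neg-involutive (val x))

  neg-injective : (x y : X n) → neg x ≡ neg y → x ≡ y
  neg-injective x y eq =
    trans (sym (neg-involutive x)) (trans (cong neg eq) (neg-involutive y))

  swap-left : (a b : X n) → swap a b a ≡ b
  swap-left a b rewrite dec-true (val a ℤ.≟ val a) refl = refl

  swap-right : (a b : X n) → swap a b b ≡ a
  swap-right a b with val b ℤ.≟ val a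
  ... | yes b≡a = val-injective b≡a
  ... | no  _ rewrite dec-true (val b ℤ.≟ val b) refl = refl

  swap-other : (a b : X n) {x : X n} → x ≢ a → x ≢ b → swap a b x ≡ x
  swap-other a b {x} x≢a x≢b
    rewrite dec-false (val x ℤ.≟ val a) (x≢a ∘ val-injective)
          | dec-false (val x ℤ.≟ val b) (x≢b ∘ val-injective) = refl

  data View (a b x : X n) : Set where
    at-left   : x ≡ a → View a b x
    at-right  : x ≡ b → View a b x
    elsewhere : x ≢ a → x ≢ b → View a b x

  view : (a b x : X n) → View a b x
  view a b x with val x ℤ.≟ val a | val x ℤ.≟ val b
  ... | yes p | _     = at-left (val-injective p)
  ... | no  _ | yes q = at-right (val-injective q)
  ... | no  p | no  q = elsewhere (p ∘ cong val) (q ∘ cong val)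

  swap-involutive : (a b x : X n) → swap a b (swap a b x) ≡ x
  swap-involutive a b x with view a b x
  ... | at-left  refl  = trans (cong (swap a b) (swap-left a b)) (swap-right a b)
  ... | at-right refl  = trans (cong (swap a b) (swap-right a b)) (swap-left a b)
  ... | elsewhere p q   = trans (cong (swap a b) (swap-other a b p q)) (swap-other a b p q)

  swap-comm : (a b x : X n) → swap a b x ≡ swap b a x
  swap-comm a b x with view a b x
  ... | at-left  refl = trans (swap-left a b) (sym (swap-right b a))
  ... | at-right refl = trans (swap-right a b) (sym (swap-left b a))
  ... | elsewhere p q  = trans (swap-other a b p q) (sym (swap-other b a q p))

  swap-neg : (a b x : X n) → swap (neg a) (neg b) (neg x) ≡ neg (swap a b x)
  swap-neg a b x with view a b x
  ... | at-left  refl = trans (swap-left (neg a) (neg b)) (sym (cong neg (swap-left a b)))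
  ... | at-right refl = trans (swap-right (neg a) (neg b)) (sym (cong neg (swap-right a b)))
  ... | elsewhere p q  =
    trans (swap-other (neg a) (neg b) {neg x} (p ∘ neg-injective x a) (q ∘ neg-injective x b))
          (sym (cong neg (swap-other a b {x} p q)))

  swap-commute : (a b c d : X n) → a ≢ c → a ≢ d → b ≢ c → b ≢ d →
                 ∀ x → swap a b (swap c d x) ≡ swap c d (swap a b x)
  swap-commute a b c d a≢c a≢d b≢c b≢d x with view a b x
  ... | at-left refl = trans (cong (swap a b) (swap-other c d a≢c a≢d))
          (trans (swap-left a b)
          (sym (trans (cong (swap c d) (swap-left a b)) (swap-other c d b≢c b≢d))))
  ... | at-right refl = trans (cong (swap a b) (swap-other c d b≢c b≢d))
          (trans (swap-right a b)
          (sym (trans (cong (swap c d) (swap-right a b)) (swap-other c d a≢c a≢d))))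
  ... | elsewhere p q with view c d x
  ...   | at-left refl = trans (cong (swap a b) (swap-left c d))
            (trans (swap-other a b (a≢d ∘ sym) (b≢d ∘ sym))
            (sym (trans (cong (swap c d) (swap-other a b p q)) (swap-left c d))))
  ...   | at-right refl = trans (cong (swap a b) (swap-right c d))
            (trans (swap-other a b (a≢c ∘ sym) (b≢c ∘ sym))
            (sym (trans (cong (swap c d) (swap-other a b p q)) (swap-right c d))))
  ...   | elsewhere r t =
            trans (cong (swap a b) (swap-other c d r t))
            (trans (swap-other a b p q)
            (sym (trans (cong (swap c d) (swap-other a b p q)) (swap-other c d r t))))

transposition : (a b : X n) → X n ↔ X n
transposition a b =
  mk↔ₛ′ (swap a b) (swap a b) (swap-involutive a b) (swap-involutive a b)

------------------------------------------------------------------------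
-- The group W_n of signed permutations and its simple reflections

record W (n : ℕ) : Set where
  constructor mkW
  field
    perm : X n ↔ X n
    odd  : ∀ x → Inverse.to perm (neg x) ≡ neg (Inverse.to perm x)
open W public

infixl 8 _⟨$⟩_
_⟨$⟩_ : W n → X n → X n
w ⟨$⟩ x = Inverse.to (perm w) x

infix 4 _≈_
_≈_ : Rel (W n) 0ℓ
v ≈ w = ∀ x → v ⟨$⟩ x ≡ w ⟨$⟩ x

ε : W n
ε = mkW (↔-id _) (λ _ → refl)

infixl 7 _·_
_·_ : W n → W n → W n
v · w = mkW (perm v ↔-∘ perm w) λ x → trans (cong (v ⟨$⟩_) (odd w x)) (odd v (w ⟨$⟩ x))

infix 9 _⁻¹
_⁻¹ : W n → W n
w ⁻¹ = mkW (↔-sym (perm w)) λ x →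
  trans (cong (from ∘ neg) (sym (strictlyInverseˡ x)))
  (trans (cong from (sym (odd w (from x)))) (strictlyInverseʳ (neg (from x))))
  where open Inverse (perm w)

private
  swap-odd : (b x : X n) → swap (neg b) b (neg x) ≡ neg (swap (neg b) b x)
  swap-odd b x =
    trans (cong (λ c → swap (neg b) c (neg x)) (sym (neg-involutive b)))
    (trans (swap-neg b (neg b) x) (cong neg (swap-comm b (neg b) x)))

  swap²-odd : (a b : X n) → (∀ y → swap (neg a) (neg b) (swap a b y) ≡ swap a b (swap (neg a) (neg b) y)) →
              ∀ x → swap a b (swap (neg a) (neg b) (neg x)) ≡ neg (swap a b (swap (neg a) (neg b) x))
  swap²-odd a b commute x =
    trans (cong (swap a b) (swap-neg a b x))
    (trans (cong₂′ (neg-involutive a) (neg-involutive b))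
    (trans (swap-neg (neg a) (neg b) (swap a b x)) (cong neg (commute x))))
    where
    cong₂′ : ∀ {a′ b′} → a′ ≡ a → b′ ≡ b →
             swap a b (neg (swap a b x)) ≡ swap a′ b′ (neg (swap a b x))
    cong₂′ refl refl = refl

  pos≢neg : ∀ i j .(p : suc i ≤ n) .(q : suc j ≤ n) → neg (pt (suc i) p) ≢ pt (suc j) q
  pos≢neg i j p q eq with cong val eq
  ... | ()

s : Fin n → W n
s {suc n} zero    = mkW (transposition (neg one) one) (swap-odd one)
  where
  one : X (suc n)
  one = pt 1 (s≤s z≤n)
s {suc n} (suc i) = mkW (transposition a b ↔-∘ transposition (neg a) (neg b))
  (swap²-odd a b (swap-commute (neg a) (neg b) a b
    (pos≢neg j j j≤ j≤) (pos≢neg j (suc j) j≤ j<) (pos≢neg (suc j) j j< j≤) (pos≢neg (suc j) (suc j) j< j<)))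
  where
  j = toℕ i
  j< : suc (suc j) ≤ suc n
  j< = s≤s (toℕ<n i)
  j≤ : suc j ≤ suc n
  j≤ = <⇒≤ j<
  a b : X (suc n)
  a = pt (suc j) j≤
  b = pt (suc (suc j)) j<

∏ : List (W n) → W n
∏ = foldr _·_ ε

------------------------------------------------------------------------
-- Length, Bruhat order, 0-Hecke product

word : List (Fin n) → W n
word is = foldr (λ i w → s i · w) ε is

-- The Coxeter length is a relation, ℓ[ w ]= d, rather than a function: making
-- it a function would first require proving that s₀, …, s_{n-1} generate W_n.
infix 4 ℓ[_]=_
record ℓ[_]=_ (w : W n) (d : ℕ) : Set where
  field
    letters : List (Fin n)
    spells  : word letters ≈ w
    size    : length letters ≡ d
    minimal : ∀ is → word is ≈ w → d ≤ length is

infix 4 _ℓ<_ _ℓ≤_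
_ℓ<_ _ℓ≤_ : Rel (W n) 0ℓ
v ℓ< w = ∃₂ λ a b → ℓ[ v ]= a × ℓ[ w ]= b × a < b
v ℓ≤ w = ∃₂ λ a b → ℓ[ v ]= a × ℓ[ w ]= b × a ≤ b

IsSimple : W n → Set
IsSimple w = ∃[ i ] w ≈ s i

IsReflection : W n → Set
IsReflection t = ∃₂ λ g i → t ≈ g · s i · g ⁻¹

-- Bruhat order: generated by u < u t for t a reflection with ℓ(u) < ℓ(u t).
infix 4 _≤ᴮ_
data _≤ᴮ_ {n : ℕ} (u : W n) : W n → Set where
  stop : ∀ {v} → u ≈ v → u ≤ᴮ v
  step : ∀ {t v} → IsReflection t → u ℓ< u · t → u · t ≤ᴮ v → u ≤ᴮ v

-- is ⋆ w ↦ v : the iterated product s_{i₁} * (s_{i₂} * ( … * (s_{i_d} * w))) is v.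
infix 4 _⋆_↦_ _*_↦_
data _⋆_↦_ {n : ℕ} : List (Fin n) → W n → W n → Set where
  []   : ∀ {w v} → w ≈ v → [] ⋆ w ↦ v
  up   : ∀ {i is w u v} → is ⋆ w ↦ u → u ℓ< s i · u → s i · u ≈ v → i ∷ is ⋆ w ↦ v
  stay : ∀ {i is w u v} → is ⋆ w ↦ u → ¬ (u ℓ< s i · u) → u ≈ v → i ∷ is ⋆ w ↦ v

_*_↦_ : W n → W n → W n → Set
x * w ↦ v = ∃[ is ] word is ≈ x × ℓ[ x ]= length is × is ⋆ w ↦ v

-- x . y is a reduced product in W: ℓ(x y) = ℓ(x) + ℓ(y).
LengthsAdd : W n → W n → Set
LengthsAdd x y = ∃₂ λ a b → ℓ[ x ]= a × ℓ[ y ]= b × ℓ[ x · y ]= a + b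

record IsReducedExpression (w : W n) (vs : List (W n)) : Set where
  field
    simple  : All IsSimple vs
    product : ∏ vs ≈ w
    reduced : ℓ[ w ]= length vs

------------------------------------------------------------------------
-- Parabolic subgroups; a subset I of S is the set of i with s_i ∈ I

infix 4 _∈⟨_⟩
_∈⟨_⟩ : W n → Subset n → Set
w ∈⟨ I ⟩ = ∃[ is ] All (_∈ I) is × word is ≈ w

IsLongest : Subset n → W n → Set
IsLongest I w = w ∈⟨ I ⟩ × (∀ x → x ∈⟨ I ⟩ → x ℓ≤ w)

------------------------------------------------------------------------
-- Double cosets

-- The coset W_I rep W_J together with the data I (left) and J (right).
record Coset (n : ℕ) : Set where
  constructor mkCoset
  field
    left  : Subset n
    rep   : W n
    right : Subset n
open Coset public

infix 4 _∈ᶜ_ _≈ᶜ_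
_∈ᶜ_ : W n → Coset n → Set
y ∈ᶜ p = ∃₂ λ a b → a ∈⟨ left p ⟩ × b ∈⟨ right p ⟩ × y ≈ a · rep p · b

_≈ᶜ_ : Rel (Coset n) 0ℓ
p ≈ᶜ q = left p ≡ left q × right p ≡ right q × rep p ∈ᶜ q

IsMin IsMax : Coset n → W n → Set
IsMin p x = x ∈ᶜ p × (∀ y → y ∈ᶜ p → x ≤ᴮ y)
IsMax p x = x ∈ᶜ p × (∀ y → y ∈ᶜ p → y ≤ᴮ x)

-- I = x J x⁻¹ as sets of simple reflections.
_^_≐_ : Subset n → W n → Subset n → Set
J ^ x ≐ I = (∀ {i} → i ∈ I → ∃[ j ] j ∈ J × s i ≈ x · s j · x ⁻¹)
          × (∀ {j} → j ∈ J → ∃[ i ] i ∈ I × s i ≈ x · s j · x ⁻¹)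

IsCore : Coset n → Set
IsCore p = ∃[ x ] IsMin p x × right p ^ x ≐ left p

-- p is the reduced composition q . r. With u = q̄ * r̄ and w = w_J, J the common
-- subset, the length condition is ℓ(u) = ℓ(q̄) - ℓ(w) + ℓ(r̄).
record IsReducedComposition (p q r : Coset n) : Set where
  field
    composable : right q ≡ left r
    left≡      : left p ≡ left q
    right≡     : right p ≡ right r
    {q̄ r̄ u w} : W n
    max-q      : IsMax q q̄
    max-r      : IsMax r r̄
    star       : q̄ * r̄ ↦ u
    composite  : u ∈ᶜ p
    longest    : IsLongest (right q) w
    product    : u ≈ q̄ · w ⁻¹ · r̄
    lengths    : ∃₂ λ a b → ∃₂ λ c d →
                 ℓ[ u ]= a × ℓ[ q̄ ]= b × ℓ[ w ]= c × ℓ[ r̄ ]= d × a + c ≡ b + d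

identity : Subset n → Coset n
identity I = mkCoset I ε I

-- q ⟫[ ps ]⇒ r : composing q successively with the members of ps gives r, each
-- binary composition being reduced. Expressions start from an identity coset,
-- which also covers the empty sequence; (identity I) . p₁ = p₁ is always reduced.
data _⟫[_]⇒_ {n : ℕ} (q : Coset n) : List (Coset n) → Coset n → Set where
  done : ∀ {r} → q ≈ᶜ r → q ⟫[ [] ]⇒ r
  step : ∀ {q′ p ps r} → IsReducedComposition q′ q p → q′ ⟫[ ps ]⇒ r → q ⟫[ p ∷ ps ]⇒ r

IsReducedFactorisation : Coset n → List (Coset n) → Set
IsReducedFactorisation p ps = identity (left p) ⟫[ ps ]⇒ p

record IsAtomic (p : Coset n) : Set where
  field
    M       : Subset n
    {σ τ}   : Fin n
    {w}     : W n
    σ∈M     : σ ∈ M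
    longest : IsLongest M w
    τ≈      : s τ ≈ w · s σ · w
    left≡   : left p ≡ M - σ
    right≡  : right p ≡ M - τ
    w∈p     : w ∈ᶜ p

-- Core and atomic cosets whose right subset has m elements; for core (hence for
-- atomic) cosets the left subset then has m elements as well.
record CoreCoset (n m : ℕ) : Set where
  constructor mkCore
  field
    coset  : Coset n
    isCore : IsCore coset
    size   : ∣ right coset ∣ ≡ m

record AtomicCoset (n m : ℕ) : Set where
  constructor mkAtomic
  field
    coset    : Coset n
    isAtomic : IsAtomic coset
    size     : ∣ right coset ∣ ≡ m

toCore : (∀ {p : Coset n} → IsAtomic p → IsCore p) → AtomicCoset n m → CoreCoset n m
toCore core a = mkCore coset (core isAtomic) size
  where open AtomicCoset a

------------------------------------------------------------------------
-- Squashing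

data Adjacent {n : ℕ} (J : Subset n) : Rel (X n) 0ℓ where
  adj⁺ : ∀ {j x y} → j ∈ J → val x ≡ + toℕ j → val y ≡ + suc (toℕ j) → Adjacent J x y
  adj⁻ : ∀ {j x y} → j ∈ J → val x ≡ ℤ.- (+ toℕ j) → val y ≡ -[1+ toℕ j ] → Adjacent J x y

infix 4 _∼[_]_
_∼[_]_ : X n → Subset n → X n → Set
x ∼[ J ] y = EqClosure (Adjacent J) x y

-- label x = c means x ∈ C_c; the conditions determine label.
record Labelling (J : Subset n) (k : ℕ) : Set where
  field
    label      : X n → X k
    sound      : ∀ {x y} → x ∼[ J ] y → label x ≡ label y
    complete   : ∀ {x y} → label x ≡ label y → x ∼[ J ] y
    surjective : ∀ c → ∃[ x ] label x ≡ c
    monotone   : ∀ {x y} → val x ℤ.≤ val y → val (label x) ℤ.≤ val (label y)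
    zero-class : label (pt 0 z≤n) ≡ pt 0 z≤n
    symmetric  : ∀ x → label (neg x) ≡ neg (label x)

-- y is a block permutation relative to I and J inducing v on Y_k.
record IsSquash (I J : Subset n) (y : W n) (v : W k) : Set where
  field
    labelᴵ : Labelling I k
    labelᴶ : Labelling J k

  C : (c : X k) → X n → Set
  C c x = Labelling.label labelᴶ x ≡ c

  C′ : (c : X k) → X n → Set
  C′ c x = Labelling.label labelᴵ x ≡ c

  field
    into  : ∀ c {x} → C c x → C′ (v ⟨$⟩ c) (y ⟨$⟩ x)
    onto  : ∀ c {x′} → C′ (v ⟨$⟩ c) x′ → ∃[ x ] C c x × y ⟨$⟩ x ≡ x′
    order : ∀ c {x₁ x₂} → C c x₁ → C c x₂ → val x₁ ℤ.< val x₂ →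
            val (y ⟨$⟩ x₁) ℤ.< val (y ⟨$⟩ x₂)

IsSquashing : (CoreCoset n m → W k) → Set
IsSquashing Sq = ∀ p x → let open CoreCoset p in
  IsMin coset x → IsSquash (left coset) (right coset) x (Sq p)

------------------------------------------------------------------------
-- Bijections between subsets

-- f maps the subset P of A into the subset Q of B, bijectively up to the
-- equalities of A and B.
RestrictsToBijection : ∀ {A B : Set} → Rel A 0ℓ → Rel B 0ℓ →
                       (A → Set) → (B → Set) → (A → B) → Set
RestrictsToBijection {A} {B} _≈₁_ _≈₂_ P Q f =
  Σ[ lands ∈ (∀ {x} → P x → Q (f x)) ]
  IsBijection {A = Σ A P} (_≈₁_ on proj₁) {B = Σ B Q} (_≈₂_ on proj₁) (Product.map f lands)

{-# OPTIONS --safe #-}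

-- Lengths are never counted. By the exchange condition, multiplying by s_i on the right changes the
-- length by one, up or down according to the order of the images of i and i + 1; hence
-- ℓ(x y) = ℓ(x) + ℓ(y) exactly when no pair inverted by y is inverted back by x (Additive), and then
-- x ≤ x y in the Bruhat order.
--
-- The minimal element of a core (I,J)-coset is an isomorphism between the graphs of I- and J-links on
-- X (Block), so it induces a permutation of the classes. Since block permutations invert two points
-- only if they invert their classes, additivity passes between x, y and their squashings, and a block
-- permutation that squashes to the identity is increasing, hence trivial; this gives injectivity.
-- Writing w_J for the longest element of W_J, additivity for x, y is also what makes the composition
-- with maxima x w_J and y w_K reduced.
--
-- An atomic coset has minimal element w_M w_J. It preserves the classes of M, which merge only the
-- two J-classes adjacent across τ, so its squashing has no inversion except across that gap and is
-- the simple reflection there. Surjectivity follows since simple reflections generate W_k.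
module Submission where

open import Defs
open import Data.Fin using (Fin; zero; suc; toℕ; fromℕ<)
open import Data.Fin.Properties using (any?; suc-injective; toℕ<n; toℕ-fromℕ<; toℕ-injective)
  renaming (_≟_ to _≟ᶠ_)
open import Data.Fin.Subset using (Subset; inside; outside; _∈_; _∉_; _-_; _∪_; ∣_∣; ⁅_⁆)
open import Data.Fin.Subset.Properties
  using (_∈?_; p─q⊆p; x∈p∧x≢y⇒x∈p-y; x∈p∪q⁺; x∈p∪q⁻; x∈p⇒∣p-x∣<∣p∣; x∈⁅x⁆; x∈⁅y⁆⇒x≡y; ⊆-antisym)
open import Data.Integer as ℤ using (ℤ; +_; -[1+_])
import Data.Integer.Properties as ℤ
open import Data.List using (List; []; _∷_; _++_; length; map; initLast; _∷ʳ′_)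
open import Data.List.Properties using (length-++; length-map)
open import Data.List.Relation.Binary.Pointwise as Pointwise using (Pointwise; []; _∷_)
open import Data.List.Relation.Unary.All as All using (All; []; _∷_)
import Data.List.Relation.Unary.All.Properties as All
open import Data.Nat as ℕ using (ℕ; zero; suc; z≤n; s≤s; _∸_)
import Data.Nat.Properties as ℕ
open import Data.Nat.Solver using (module +-*-Solver)
open import Data.Product using (Σ-syntax; ∃-syntax; _×_; _,_; proj₁; proj₂)
open import Data.Sum using (_⊎_; inj₁; inj₂)
open import Data.Vec using (_∷_; []; here; there)
open import Function using (_∘_; _on_; Inverse; mk↔ₛ′)
open import Function.Structures using (IsBijection)
open import Level using (0ℓ)
open import Relation.Binary using (IsEquivalence; Rel; Transitive; Tri; tri<; tri≈; tri>)
import Relation.Binary.Construct.Closure.Equivalence as Eq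
open import Relation.Binary.Construct.Closure.ReflexiveTransitive using (_◅_; _◅◅_) renaming (ε to refl*)
open import Relation.Binary.Construct.Closure.Symmetric using (bwd)
open import Relation.Binary.Construct.Closure.Transitive using (TransClosure; [_]; _∷_; transitive)
import Relation.Binary.Construct.On as On
open import Relation.Binary.PropositionalEquality
  using (_≡_; _≢_; _≗_; refl; sym; trans; cong; cong₂; subst; subst₂; isEquivalence)
open import Relation.Nullary using (¬_; Dec; yes; no; contradiction; recompute; _×-dec_)
open import Relation.Nullary.Decidable using (dec-true; dec-false)
open CoreCoset using (coset)
open AtomicCoset using () renaming (coset to acoset)

-- Keeping the fixed point 0 in X puts s₀ on the same footing as the other reflections: `i` is a
-- descent of `w` exactly when `w` inverts i and i + 1, also for i = 0. The price is that the two
-- edges of index 0 share a vertex, so s₀ also flips the pair (-1, 1), which is not an edge; the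
-- exchange argument has to exclude this pair. Words and Bruhat chains are awkward to manipulate, so
-- W_J and w_J are replaced by conditions on points: `Preserves` says that no point leaves its
-- class, `Reverses` that linked points are moreover inverted. Identities between permutations then
-- follow by showing that a suitable product is monotone. A reversal is not a block permutation in
-- general, but its product with the central element `ω` = -1 is. In w_M w_J the two signs cancel,
-- which is why the minimal elements of atomic cosets are block permutations, with no formula for
-- w_M.

private
  variable
    n m d e : ℕ
    i j : Fin n
    I J K : Subset n
    a b c : X n
    u v w x y z : W n
    p q r : Coset n

-- The linear order on X

infix 4 _≺_
-- Wrapped in a record so that the two points, and not just their values, can be inferred from a
-- proof.
record _≺_ {n : ℕ} (a b : X n) : Set where
  constructor ⟨_⟩
  field
    below : val a ℤ.< val b
open _≺_ public

cmp : (a b : X n) → Tri (a ≺ b) (a ≡ b) (b ≺ a)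
cmp a b with ℤ.<-cmp (val a) (val b)
... | tri< p q r = tri< ⟨ p ⟩ (q ∘ cong val) (r ∘ below)
... | tri≈ p q r = tri≈ (p ∘ below) (val-injective q) (r ∘ below)
... | tri> p q r = tri> (p ∘ below) (q ∘ cong val) ⟨ r ⟩

≺-trans : Transitive (_≺_ {n})
≺-trans ⟨ p ⟩ ⟨ q ⟩ = ⟨ ℤ.<-trans p q ⟩

≺-irrefl : ¬ a ≺ a
≺-irrefl ⟨ p ⟩ = ℤ.<-irrefl refl p

≺-asym : a ≺ b → ¬ b ≺ a
≺-asym ⟨ p ⟩ ⟨ q ⟩ = ℤ.<-asym p q

neg-involutive : (a : X n) → neg (neg a) ≡ a
neg-involutive a = val-injective (ℤ.neg-involutive (val a))

neg-≺ : a ≺ b → neg b ≺ neg a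
neg-≺ ⟨ p ⟩ = ⟨ ℤ.neg-mono-< p ⟩

0̂ : X n
0̂ = pt 0 z≤n

neg-fixed : a ≡ neg a → a ≡ 0̂
neg-fixed {a = mkX (+ zero)    _} eq = refl
neg-fixed {a = mkX (+ (suc _)) _} eq = contradiction (cong val eq) λ ()
neg-fixed {a = mkX -[1+ _ ]    _} eq = contradiction (cong val eq) λ ()

Next : Rel (X n) 0ℓ
Next a b = val b ≡ ℤ.suc (val a)

next : a ≺ b → ∃[ a⁺ ] Next a a⁺
next {n} {a = mkX z p} {mkX z′ p′} ⟨ z<z′ ⟩ = mkX (ℤ.suc z) (bound z z′ p p′ z<z′) , refl
  where
  bound : ∀ z z′ → ℤ.∣ z ∣ ℕ.≤ n → ℤ.∣ z′ ∣ ℕ.≤ n → z ℤ.< z′ → ℤ.∣ ℤ.suc z ∣ ℕ.≤ n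
  bound (+ i)          (+ j) p q (ℤ.+<+ i<j) = ℕ.≤-trans i<j q
  bound -[1+ zero ]    _     p q _           = z≤n
  bound -[1+ (suc i) ] _     p q _           = ℕ.≤-trans (ℕ.n≤1+n _) p

suc-neg : ∀ i → ℤ.suc -[1+ i ] ≡ ℤ.- (+ i)
suc-neg zero    = refl
suc-neg (suc i) = refl

Next⇒≺ : (a b : X n) → Next a b → a ≺ b
Next⇒≺ a b eq = ⟨ subst (val a ℤ.<_) (sym eq) (ℤ.suc[i]≤j⇒i<j ℤ.≤-refl) ⟩

-- Induction on the number of points strictly between `a` and `b`. It reduces comparisons to
-- consecutive points, where links can be recognised.
path : a ≺ b → TransClosure Next a b
path {n} {a} {b} ⟨ a<b ⟩ = go ℤ.∣ val b ℤ.- ℤ.suc (val a) ∣ a b (sym gap)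
  where
  1+a≤b = ℤ.i<j⇒suc[i]≤j a<b
  gap : ℤ.suc (val a) ℤ.+ + ℤ.∣ val b ℤ.- ℤ.suc (val a) ∣ ≡ val b
  gap = trans (cong (λ z → ℤ.suc (val a) ℤ.+ z) (ℤ.0≤i⇒+∣i∣≡i (ℤ.i≤j⇒0≤j-i 1+a≤b)))
       (trans (ℤ.+-comm (ℤ.suc (val a)) (val b ℤ.- ℤ.suc (val a)))
       (trans (ℤ.+-assoc (val b) (ℤ.- ℤ.suc (val a)) (ℤ.suc (val a)))
       (trans (cong (λ z → val b ℤ.+ z) (ℤ.+-inverseˡ (ℤ.suc (val a)))) (ℤ.+-identityʳ (val b)))))
  go : ∀ d (a b : X n) → val b ≡ ℤ.suc (val a) ℤ.+ + d → TransClosure Next a b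
  go zero    a b eq = [ trans eq (ℤ.+-identityʳ _) ]
  go (suc d) a b eq with next {a = a} {b} ⟨ subst (val a ℤ.<_) (sym eq)
      (ℤ.<-≤-trans (ℤ.suc[i]≤j⇒i<j ℤ.≤-refl) (ℤ.i≤i+j _ (+ suc d))) ⟩
  ... | a⁺ , a→a⁺ = a→a⁺ ∷ go d a⁺ b
    (trans eq (trans (sym (ℤ.+-assoc (ℤ.suc (val a)) (+ 1) (+ d)))
              (cong (ℤ._+ + d) (trans (ℤ.+-comm (ℤ.suc (val a)) (+ 1)) (cong ℤ.suc (sym a→a⁺))))))

-- Edges of the graph generating ∼[ J ]

lo hi : Fin n → X n
lo i = pt (toℕ i) (ℕ.<⇒≤ (toℕ<n i))
hi i = pt (suc (toℕ i)) (toℕ<n i)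

-- Unlike `Adjacent`, every edge points upwards, so a map that preserves edges is increasing along
-- them. The two edges of index 0 form the chain -1, 0, 1.
data Edge (j : Fin n) (a b : X n) : Set where
  plus  : a ≡ lo j → b ≡ hi j → Edge j a b
  minus : a ≡ neg (hi j) → b ≡ neg (lo j) → Edge j a b

base : (j : Fin n) → Edge j (lo j) (hi j)
base j = plus refl refl

Link : Subset n → Rel (X n) 0ℓ
Link J a b = ∃[ j ] j ∈ J × Edge j a b

Edge-neg : Edge j a b → Edge j (neg b) (neg a)
Edge-neg (plus refl refl) = minus refl refl
Edge-neg {j = j} (minus refl refl) = plus (neg-involutive (lo j)) (neg-involutive (hi j))

lo≺hi : (j : Fin n) → lo j ≺ hi j
lo≺hi j = ⟨ ℤ.+<+ (ℕ.n<1+n _) ⟩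

Edge⇒≺ : Edge j a b → a ≺ b
Edge⇒≺ (plus refl refl)  = lo≺hi _
Edge⇒≺ {j = j} (minus refl refl) = neg-≺ {a = lo j} {b = hi j} (lo≺hi j)

lo≢neghi : lo i ≢ neg (hi j)
lo≢neghi eq with cong val eq
... | ()

Edge-index : Edge i a b → Edge j a b → i ≡ j
Edge-index (plus refl refl)  (plus p _)  = toℕ-injective (ℤ.+-injective (cong val p))
Edge-index (plus refl refl)  (minus p _) = contradiction p lo≢neghi
Edge-index (minus refl refl) (plus p _)  = contradiction (sym p) lo≢neghi
Edge-index (minus refl refl) (minus p _) = toℕ-injective (ℤ.-[1+-injective (cong val p))

link⇒∼ : Link J a b → a ∼[ J ] b
link⇒∼ (j , j∈J , plus refl refl)  = Eq.return (adj⁺ j∈J refl refl)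
link⇒∼ (j , j∈J , minus refl refl) = bwd (adj⁻ j∈J refl refl) ◅ refl*

∼-sym : a ∼[ J ] b → b ∼[ J ] a
∼-sym = Eq.symmetric _

-- Labels: the class of a ≥ 0 is numbered by the j < a with s_j ∉ J

cnt : Subset n → ℕ → ℕ
cnt []            _       = 0
cnt (_       ∷ _) zero    = 0
cnt (inside  ∷ J) (suc a) = cnt J a
cnt (outside ∷ J) (suc a) = suc (cnt J a)

cnt-zero : (J : Subset n) → cnt J 0 ≡ 0
cnt-zero []      = refl
cnt-zero (_ ∷ _) = refl

cnt-suc : (J : Subset n) (a : ℕ) → cnt J a ℕ.≤ cnt J (suc a)
cnt-suc []            a       = z≤n
cnt-suc (_ ∷ _)       zero    = z≤n
cnt-suc (inside  ∷ J) (suc a) = cnt-suc J a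
cnt-suc (outside ∷ J) (suc a) = s≤s (cnt-suc J a)

cnt-mono : (J : Subset n) {a b : ℕ} → a ℕ.≤ b → cnt J a ℕ.≤ cnt J b
cnt-mono J {a} a≤b = go (ℕ.≤⇒≤′ a≤b)
  where
  go : ∀ {b} → a ℕ.≤′ b → cnt J a ℕ.≤ cnt J b
  go ℕ.≤′-refl     = ℕ.≤-refl
  go (ℕ.≤′-step p) = ℕ.≤-trans (go p) (cnt-suc J _)

cnt-total : (J : Subset n) → cnt J n ≡ n ∸ ∣ J ∣
cnt-total J = trans (sym (ℕ.m+n∸n≡m (cnt J _) ∣ J ∣)) (cong (_∸ ∣ J ∣) (go J))
  where
  go : ∀ {n} (J : Subset n) → cnt J n ℕ.+ ∣ J ∣ ≡ n
  go []            = refl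
  go (inside  ∷ J) = trans (ℕ.+-suc (cnt J _) ∣ J ∣) (cong suc (go J))
  go (outside ∷ J) = cong suc (go J)

cnt-∈ : {J : Subset n} → j ∈ J → cnt J (toℕ j) ≡ cnt J (suc (toℕ j))
cnt-∈ {J = .inside ∷ J} here = sym (cnt-zero J)
cnt-∈ {J = inside  ∷ J} (there p) = cnt-∈ p
cnt-∈ {J = outside ∷ J} (there p) = cong suc (cnt-∈ p)

cnt-∉ : (j : Fin n) (J : Subset n) → j ∉ J → cnt J (suc (toℕ j)) ≡ suc (cnt J (toℕ j))
cnt-∉ zero    (inside  ∷ J) j∉J = contradiction here j∉J
cnt-∉ zero    (outside ∷ J) j∉J = cong suc (cnt-zero J)
cnt-∉ (suc j) (inside  ∷ J) j∉J = cnt-∉ j J (j∉J ∘ there)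
cnt-∉ (suc j) (outside ∷ J) j∉J = cong suc (cnt-∉ j J (j∉J ∘ there))

cnt-flat : (j : Fin n) (J : Subset n) → cnt J (toℕ j) ≡ cnt J (suc (toℕ j)) → j ∈ J
cnt-flat zero    (inside  ∷ J) eq = here
cnt-flat (suc j) (inside  ∷ J) eq = there (cnt-flat j J eq)
cnt-flat (suc j) (outside ∷ J) eq = there (cnt-flat j J (ℕ.suc-injective eq))

cnt-jump : (J : Subset n) (c : ℕ) → c ℕ.< cnt J n → ∃[ j ] j ∉ J × cnt J (toℕ j) ≡ c
cnt-jump (outside ∷ J) zero    _ = zero , (λ ()) , refl
cnt-jump (inside  ∷ J) c       p with cnt-jump J c p
... | j , j∉J , eq = suc j , (λ { (there q) → j∉J q }) , eq
cnt-jump (outside ∷ J) (suc c) (s≤s p) with cnt-jump J c p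
... | j , j∉J , eq = suc j , (λ { (there q) → j∉J q }) , cong suc eq

cnt-surj : (J : Subset n) (c : ℕ) → c ℕ.≤ cnt J n → ∃[ a ] a ℕ.≤ n × cnt J a ≡ c
cnt-surj J zero    _ = 0 , z≤n , cnt-zero J
cnt-surj J (suc c) p with cnt-jump J c p
... | j , j∉J , eq = suc (toℕ j) , toℕ<n j , trans (cnt-∉ j J j∉J) (cong suc eq)

labℤ : Subset n → ℤ → ℤ
labℤ J (+ a)    = + cnt J a
labℤ J -[1+ a ] = ℤ.- (+ cnt J (suc a))

labℤ-neg : (J : Subset n) (z : ℤ) → labℤ J (ℤ.- z) ≡ ℤ.- labℤ J z
labℤ-neg J (+ zero)  rewrite cnt-zero J = refl
labℤ-neg J (+ suc a) = refl
labℤ-neg J -[1+ a ]  = sym (ℤ.neg-involutive _)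

labℤ-mono : (J : Subset n) {y z : ℤ} → y ℤ.≤ z → labℤ J y ℤ.≤ labℤ J z
labℤ-mono J (ℤ.-≤- p) = ℤ.neg-mono-≤ (ℤ.+≤+ (cnt-mono J (s≤s p)))
labℤ-mono J ℤ.-≤+     = ℤ.≤-trans (ℤ.neg-mono-≤ (ℤ.+≤+ z≤n)) (ℤ.+≤+ z≤n)
labℤ-mono J (ℤ.+≤+ p) = ℤ.+≤+ (cnt-mono J p)

labℤ-bound : (J : Subset n) (z : ℤ) → ℤ.∣ z ∣ ℕ.≤ n → ℤ.∣ labℤ J z ∣ ℕ.≤ cnt J n
labℤ-bound J (+ a)    p = cnt-mono J p
labℤ-bound J -[1+ a ] p = subst (ℕ._≤ _) (sym (ℤ.∣-i∣≡∣i∣ (+ cnt J (suc a)))) (cnt-mono J p)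

-- The size is irrelevant, so labels obtained from different proofs coincide. With `m = ∣ J ∣` and
-- `refl`, labels also decide `∼[ J ]` for a subset of arbitrary size.
lab : (J : Subset n) → .(∣ J ∣ ≡ m) → X n → X (n ∸ m)
lab {n} {m} J size (mkX z p) = mkX (labℤ J z)
  (ℕ.≤-trans (labℤ-bound J z p) (ℕ.≤-reflexive (trans (cnt-total J) (cong (n ∸_) size))))

module _ (J : Subset n) .(size : ∣ J ∣ ≡ m) where

  lab-neg : ∀ a → lab J size (neg a) ≡ neg (lab J size a)
  lab-neg a = val-injective (labℤ-neg J (val a))

  lab-0̂ : lab J size 0̂ ≡ 0̂
  lab-0̂ = val-injective (cong +_ (cnt-zero J))

  lab-mono : {a b : X n} → val a ℤ.≤ val b → val (lab J size a) ℤ.≤ val (lab J size b)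
  lab-mono = labℤ-mono J

  lab-cancel : lab J size a ≺ lab J size b → a ≺ b
  lab-cancel {a} {b} ⟨ p ⟩ = ⟨ ℤ.≰⇒> (λ b≤a → ℤ.<⇒≱ p (lab-mono {b} {a} b≤a)) ⟩

  lab-≺ : a ≺ b → lab J size a ≢ lab J size b → lab J size a ≺ lab J size b
  lab-≺ {a} {b} ⟨ a<b ⟩ ≢ = ⟨ ℤ.≤∧≢⇒< (lab-mono {a} {b} (ℤ.<⇒≤ a<b)) (≢ ∘ val-injective) ⟩

  lab-Edge : ∀ {a b} → j ∈ J → Edge j a b → lab J size a ≡ lab J size b
  lab-Edge j∈J (plus refl refl) = val-injective (cong +_ (cnt-∈ j∈J))
  lab-Edge {j} j∈J (minus refl refl) =
    trans (lab-neg (hi j)) (trans (cong neg (sym (lab-Edge j∈J (base j)))) (sym (lab-neg (lo j))))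

  lab-sound : ∀ {a b} → a ∼[ J ] b → lab J size a ≡ lab J size b
  lab-sound = Eq.gfold {S = _≡_} isEquivalence (lab J size) adjacent
    where
    adjacent : ∀ {a b} → Adjacent J a b → lab J size a ≡ lab J size b
    adjacent {a} {b} (adj⁺ j∈J p q) = lab-Edge {a = a} {b} j∈J
        (plus (val-injective p) (val-injective q))
    adjacent {a} {b} (adj⁻ j∈J p q) = sym (lab-Edge {a = b} {a} j∈J
        (minus (val-injective q) (val-injective p)))

  private
    flat-Link : ∀ i .(p : i ℕ.≤ n) .(q : suc i ℕ.≤ n) → cnt J i ≡ cnt J (suc i) →
                Link J (pt i p) (pt (suc i) q)
    flat-Link i p q eq =
      fromℕ< q , cnt-flat (fromℕ< q) J (subst (λ i → cnt J i ≡ cnt J (suc i)) (sym (toℕ-fromℕ< q)) eq) ,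
      plus (val-injective (cong +_ (sym (toℕ-fromℕ< q))))
           (val-injective (cong (+_ ∘ suc) (sym (toℕ-fromℕ< q))))

  lab-Next : Next a b → lab J size a ≡ lab J size b → Link J a b
  lab-Next {mkX (+ i) p} {mkX _ q} refl eq = flat-Link i p q (ℤ.+-injective (cong val eq))
  -- The mirror image of this pair is i, i + 1, where equal labels mean that `cnt` is flat.
  lab-Next {mkX -[1+ i ] p} {mkX z q} a→b eq
    with flat-Link i (ℕ.≤-trans (ℕ.n≤1+n i) p) p (sym (ℤ.+-injective (ℤ.neg-injective
           (trans (cong val eq) (trans (cong (labℤ J) (trans a→b (suc-neg i))) (labℤ-neg J (+ i)))))))
  ... | j , j∈J , e = j , j∈J , subst (Edge j _) (val-injective (sym (trans a→b (suc-neg i))))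
      (Edge-neg e)

  -- Between two points of one class all points have the same label, so consecutive ones are linked.
  lab-along : {R : Rel (X n) 0ℓ} → Transitive R → (∀ {a b} → Link J a b → R a b) →
              a ≺ b → lab J size a ≡ lab J size b → R a b
  lab-along {R = R} R-trans link⇒R a≺b = go (path a≺b)
    where
    ascends : ∀ {a b} → TransClosure Next a b → val a ℤ.≤ val b
    ascends {a} {b} [ p ] = ℤ.<⇒≤ (below (Next⇒≺ a b p))
    ascends {a} (_∷_ {y = c} p q) = ℤ.≤-trans (ℤ.<⇒≤ (below (Next⇒≺ a c p))) (ascends q)

    go : ∀ {a b} → TransClosure Next a b → lab J size a ≡ lab J size b → R a b
    go [ p ] eq = link⇒R (lab-Next p eq)
    go {a} {b} (_∷_ {y = c} p q) eq = R-trans (link⇒R (lab-Next p a=c)) (go q (trans (sym a=c) eq))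
      where
      a=c : lab J size a ≡ lab J size c
      a=c = val-injective (ℤ.≤-antisym (lab-mono {a = a} {c} (ℤ.<⇒≤ (below (Next⇒≺ a c p))))
              (ℤ.≤-trans (lab-mono {c} {b} (ascends q)) (ℤ.≤-reflexive (cong val (sym eq)))))

  lab-complete : lab J size a ≡ lab J size b → a ∼[ J ] b
  lab-complete {a} {b} eq with cmp a b
  ... | tri< p _ _    = lab-along _◅◅_ link⇒∼ p eq
  ... | tri≈ _ refl _ = refl*
  ... | tri> _ _ p    = ∼-sym (lab-along _◅◅_ link⇒∼ p (sym eq))

  private
    positive-label : ∀ i → i ℕ.≤ n ∸ m → ∃[ a ] a ℕ.≤ n × cnt J a ≡ i
    positive-label i p = cnt-surj J i (ℕ.≤-trans p (ℕ.≤-reflexive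
      (sym (trans (cnt-total J) (cong (n ∸_) (recompute (_ ℕ.≟ _) size))))))

  lab-surjective : ∀ c → ∃[ a ] lab J size a ≡ c
  lab-surjective c with sign c
    where
    sign : ∀ c → (∃[ i ] Σ[ p ∈ i ℕ.≤ n ∸ m ] c ≡ pt i p) ⊎
        (∃[ i ] Σ[ p ∈ i ℕ.≤ n ∸ m ] c ≡ neg (pt i p))
    sign (mkX (+ i)    p) = inj₁ (i , recompute (_ ℕ.≤? _) p , refl)
    sign (mkX -[1+ i ] p) = inj₂ (suc i , recompute (_ ℕ.≤? _) p , refl)
  ... | inj₁ (i , p , refl) = let a , q , eq = positive-label i p in pt a q , val-injective (cong +_ eq)
  ... | inj₂ (i , p , refl) = let a , q , eq = positive-label i p in
    neg (pt a q) , trans (lab-neg (pt a q)) (cong neg {lab J size (pt a q)} {pt i p}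
        (val-injective (cong +_ eq)))

-- The equivalence generated by links moves in both directions. Here only upward links are used, so
-- `R` may be an order pulled back along a permutation.
along : {R : Rel (X n) 0ℓ} → Transitive R → (∀ {a b} → Link J a b → R a b) →
        a ≺ b → a ∼[ J ] b → R a b
along {J = J} R-trans link⇒R a≺b a∼b = lab-along J refl R-trans link⇒R a≺b (lab-sound J refl a∼b)

labelling : (J : Subset n) → ∣ J ∣ ≡ m → Labelling J (n ∸ m)
labelling J size = record
  { label      = lab J size
  ; sound      = lab-sound J size
  ; complete   = lab-complete J size
  ; surjective = lab-surjective J size
  ; monotone   = λ {x} {y} → lab-mono J size {a = x} {y}
  ; zero-class = lab-0̂ J size
  ; symmetric  = lab-neg J size
  }

-- Inverses and monotone signed permutations

to-injective : (w : W n) → w ⟨$⟩ a ≡ w ⟨$⟩ b → a ≡ b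
to-injective w eq = trans (sym (Inverse.strictlyInverseʳ (perm w) _))
                   (trans (cong (Inverse.from (perm w)) eq) (Inverse.strictlyInverseʳ (perm w) _))

inverseˡ : (w : W n) (a : X n) → w ⟨$⟩ (w ⁻¹ ⟨$⟩ a) ≡ a
inverseˡ w = Inverse.strictlyInverseˡ (perm w)

inverseʳ : (w : W n) (a : X n) → w ⁻¹ ⟨$⟩ (w ⟨$⟩ a) ≡ a
inverseʳ w = Inverse.strictlyInverseʳ (perm w)

≗-sym : {A B : Set} {f g : A → B} → f ≗ g → g ≗ f
≗-sym p a = sym (p a)

≗-trans : {A B : Set} {f g h : A → B} → f ≗ g → g ≗ h → f ≗ h
≗-trans p q a = trans (p a) (q a)

·-cong : (u v x y : W n) → u ≈ v → x ≈ y → u · x ≈ v · y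
·-cong u v x y p q a = trans (p (x ⟨$⟩ a)) (cong (v ⟨$⟩_) (q a))

⁻¹-cong : (v w : W n) → v ≈ w → v ⁻¹ ≈ w ⁻¹
⁻¹-cong v w p a = to-injective w
  (trans (sym (p (v ⁻¹ ⟨$⟩ a))) (trans (inverseˡ v a) (sym (inverseˡ w a))))

fixes-0̂ : (w : W n) → w ⟨$⟩ 0̂ ≡ 0̂
fixes-0̂ w = neg-fixed (odd w 0̂)

Monotone : W n → Set
Monotone w = ∀ {a b} → a ≺ b → w ⟨$⟩ a ≺ w ⟨$⟩ b

reflects-≺ : (w : W n) → Monotone w → w ⟨$⟩ a ≺ w ⟨$⟩ b → a ≺ b
reflects-≺ {a = a} {b} w mono wa≺wb with cmp a b
... | tri< p _ _    = p
... | tri≈ _ refl _ = contradiction wa≺wb ≺-irrefl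
... | tri> _ _ p    = contradiction wa≺wb (≺-asym (mono p))

-- Since `w` fixes 0 and is strictly increasing, it moves no i ≥ 0 down. The same holds for its
-- inverse, so it moves none up either; oddness settles the negative points.
monotone⇒ε : (w : W n) → Monotone w → w ≈ ε
monotone⇒ε {n} w mono = fixed
  where
  expands : (w : W n) → Monotone w → ∀ i .(p : i ℕ.≤ n) → + i ℤ.≤ val (w ⟨$⟩ pt i p)
  expands w mono zero    p = ℤ.≤-reflexive (sym (cong val (fixes-0̂ w)))
  expands w mono (suc i) p = ℤ.≤-trans (ℤ.suc-mono (expands w mono i (ℕ.≤-trans (ℕ.n≤1+n i) p)))
    (ℤ.i<j⇒suc[i]≤j (below (mono {pt i (ℕ.≤-trans (ℕ.n≤1+n i) p)} {pt (suc i) p}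
        ⟨ ℤ.+<+ (ℕ.n<1+n i) ⟩)))

  mono⁻¹ : Monotone (w ⁻¹)
  mono⁻¹ {a} {b} a≺b = reflects-≺ w mono (subst₂ _≺_ (sym (inverseˡ w a)) (sym (inverseˡ w b)) a≺b)

  fixed⁺ : ∀ i .(p : i ℕ.≤ n) → w ⟨$⟩ pt i p ≡ pt i p
  fixed⁺ i p with w ⟨$⟩ pt i p in eq | expands w mono i p
  ... | mkX (+ j) q | ℤ.+≤+ i≤j = val-injective (cong +_ (ℕ.≤-antisym
        (ℤ.drop‿+≤+ (ℤ.≤-trans (expands (w ⁻¹) mono⁻¹ j q)
          (ℤ.≤-reflexive (cong val (trans (cong (w ⁻¹ ⟨$⟩_) (sym eq)) (inverseʳ w _)))))) i≤j))

  fixed : w ≈ ε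
  fixed (mkX (+ i)    p) = fixed⁺ i p
  fixed (mkX -[1+ i ] p) = trans (odd w (pt (suc i) p)) (cong neg (fixed⁺ (suc i) p))

-- Permutations preserving the classes of ∼[ J ]

∼-elim : {A : Set} {S : Rel A 0ℓ} → IsEquivalence S → (f : X n → A) →
         (∀ {a b} → Link J a b → S (f a) (f b)) → a ∼[ J ] b → S (f a) (f b)
∼-elim {J = J} {S = S} S-equiv f link⇒S = Eq.gfold S-equiv f adjacent
  where
  adjacent : ∀ {a b} → Adjacent J a b → S (f a) (f b)
  adjacent (adj⁺ j∈J p q) = link⇒S (_ , j∈J , plus (val-injective p) (val-injective q))
  adjacent (adj⁻ j∈J p q) = IsEquivalence.sym S-equiv
      (link⇒S (_ , j∈J , minus (val-injective q) (val-injective p)))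

-- The point-wise form of membership in W_J; see `member⇒preserves` and `preserves⇒member`.
Preserves : Subset n → W n → Set
Preserves J w = ∀ a → w ⟨$⟩ a ∼[ J ] a

preserves-· : Preserves J v → Preserves J w → Preserves J (v · w)
preserves-· {w = w} p q a = p (w ⟨$⟩ a) ◅◅ q a

preserves-⁻¹ : Preserves J w → Preserves J (w ⁻¹)
preserves-⁻¹ {J = J} {w} p a = ∼-sym (subst (_∼[ J ] _) (inverseˡ w a) (p (w ⁻¹ ⟨$⟩ a)))

preserves-resp : v ≈ w → Preserves J v → Preserves J w
preserves-resp {J = J} v≈w p a = subst (_∼[ J ] a) (v≈w a) (p a)

∼-or-≁ : (J : Subset n) → a ≺ b → a ∼[ J ] b ⊎ lab J refl a ≺ lab J refl b
∼-or-≁ {a = a} {b} J a≺b with cmp (lab J refl a) (lab J refl b)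
... | tri< p _ _ = inj₂ p
... | tri≈ _ p _ = inj₁ (lab-complete J refl p)
... | tri> _ _ p = contradiction a≺b (≺-asym (lab-cancel J refl p))

≁-≺ : Preserves J w → lab J refl a ≺ lab J refl b → w ⟨$⟩ a ≺ w ⟨$⟩ b
≁-≺ {J = J} {a = a} {b} p q =
  lab-cancel J refl (subst₂ _≺_ (sym (lab-sound J refl (p a))) (sym (lab-sound J refl (p b))) q)

-- Labels are unchanged by `w`, so points with different labels stay in order.
inversion⇒∼ : Preserves J w → a ≺ b → w ⟨$⟩ b ≺ w ⟨$⟩ a → a ∼[ J ] b
inversion⇒∼ {J = J} {w = w} p a≺b wb≺wa with ∼-or-≁ J a≺b
... | inj₁ a∼b = a∼b
... | inj₂ q   = contradiction wb≺wa (≺-asym (≁-≺ {w = w} p q))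

-- Ascents and descents

Ascent Descent : W n → Fin n → Set
Ascent  w i = w ⟨$⟩ lo i ≺ w ⟨$⟩ hi i
Descent w i = w ⟨$⟩ hi i ≺ w ⟨$⟩ lo i

Increasing Decreasing : Subset n → W n → Set
Increasing J w = ∀ {a b} → Link J a b → w ⟨$⟩ a ≺ w ⟨$⟩ b
Decreasing J w = ∀ {a b} → Link J a b → w ⟨$⟩ b ≺ w ⟨$⟩ a

ascent? : (w : W n) (i : Fin n) → Ascent w i ⊎ Descent w i
ascent? w i with cmp (w ⟨$⟩ lo i) (w ⟨$⟩ hi i)
... | tri< p _ _ = inj₁ p
... | tri≈ _ p _ = contradiction (subst (_≺ hi i) (to-injective w p) (lo≺hi i)) ≺-irrefl
... | tri> _ _ p = inj₂ p

≺-neg : (w : W n) → w ⟨$⟩ a ≺ w ⟨$⟩ b → w ⟨$⟩ neg b ≺ w ⟨$⟩ neg a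
≺-neg {a = a} {b} w p = subst₂ _≺_ (sym (odd w b)) (sym (odd w a)) (neg-≺ p)

ascent-Edge : (w : W n) → Ascent w i → Edge i a b → w ⟨$⟩ a ≺ w ⟨$⟩ b
ascent-Edge w p (plus refl refl)  = p
ascent-Edge w p (minus refl refl) = ≺-neg w p

descent-Edge : (w : W n) → Descent w i → Edge i a b → w ⟨$⟩ b ≺ w ⟨$⟩ a
descent-Edge w p (plus refl refl)  = p
descent-Edge w p (minus refl refl) = ≺-neg w p

Edge-ascent : (w : W n) → Edge i a b → w ⟨$⟩ a ≺ w ⟨$⟩ b → Ascent w i
Edge-ascent w (plus refl refl) p = p
Edge-ascent {i = i} w (minus refl refl) p =
  subst₂ (λ a b → w ⟨$⟩ a ≺ w ⟨$⟩ b) (neg-involutive (lo i)) (neg-involutive (hi i)) (≺-neg w p)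

Edge-descent : (w : W n) → Edge i a b → w ⟨$⟩ b ≺ w ⟨$⟩ a → Descent w i
Edge-descent w (plus refl refl) p = p
Edge-descent {i = i} w (minus refl refl) p =
  subst₂ (λ a b → w ⟨$⟩ a ≺ w ⟨$⟩ b) (neg-involutive (hi i)) (neg-involutive (lo i)) (≺-neg w p)

increasing : (w : W n) → (∀ {j} → j ∈ J → Ascent w j) → Increasing J w
increasing w p (j , j∈J , e) = ascent-Edge w (p j∈J) e

decreasing : (w : W n) → (∀ {j} → j ∈ J → Descent w j) → Decreasing J w
decreasing w p (j , j∈J , e) = descent-Edge w (p j∈J) e

increasing-∼ : (w : W n) → Increasing J w → a ≺ b → a ∼[ J ] b → w ⟨$⟩ a ≺ w ⟨$⟩ b
increasing-∼ w inc = along {R = λ a b → w ⟨$⟩ a ≺ w ⟨$⟩ b} ≺-trans inc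

decreasing-∼ : (w : W n) → Decreasing J w → a ≺ b → a ∼[ J ] b → w ⟨$⟩ b ≺ w ⟨$⟩ a
decreasing-∼ w dec = along {R = λ a b → w ⟨$⟩ b ≺ w ⟨$⟩ a} (λ p q → ≺-trans q p) dec

-- Between classes both factors keep the order, and inside a class the two reversals undo each
-- other, so the product is monotone. This yields that reversals are involutions and are unique.
reversals-cancel : (v w : W n) → Preserves J v → Decreasing J v → Preserves J w → Decreasing J w → v
    · w ≈ ε
reversals-cancel {J = J} v w pv dv pw dw = monotone⇒ε (v · w) mono
  where
  mono : Monotone (v · w)
  mono {a} {b} a≺b with ∼-or-≁ J a≺b
  ... | inj₂ q   = ≁-≺ {w = v · w} (preserves-· {v = v} {w = w} pv pw) q
  ... | inj₁ a∼b = decreasing-∼ v dv (decreasing-∼ w dw a≺b a∼b) (pw b ◅◅ ∼-sym a∼b ◅◅ ∼-sym (pw a))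

reversal-unique : (v w : W n) → Preserves J v → Decreasing J v → Preserves J w → Decreasing J w → v ≈ w
reversal-unique v w pv dv pw dw a =
  to-injective w (trans (reversals-cancel w v pw dw pv dv a) (sym (reversals-cancel w w pw dw pw dw a)))

-- Simple reflections

∈-singleton⁻ : {P : Fin n → Set} → P i → ∀ {j} → j ∈ ⁅ i ⁆ → P j
∈-singleton⁻ {i = i} {P = P} p j∈ = subst P (sym (x∈⁅y⁆⇒x≡y i j∈)) p

edge⇒∼ : Edge i a b → a ∼[ ⁅ i ⁆ ] b
edge⇒∼ {i = i} e = link⇒∼ (i , x∈⁅x⁆ i , e)

private
  swap-∼ : (a b x : X n) → a ∼[ J ] b → swap a b x ∼[ J ] x
  swap-∼ a b x a∼b with val x ℤ.≟ val a | val x ℤ.≟ val b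
  ... | yes p | _     = subst (b ∼[ _ ]_) (val-injective (sym p)) (∼-sym a∼b)
  ... | no  _ | yes q = subst (a ∼[ _ ]_) (val-injective (sym q)) a∼b
  ... | no  _ | no  _ = refl*

  swap-other : (a b x : X n) → val x ≢ val a → val x ≢ val b → swap a b x ≡ x
  swap-other a b x x≢a x≢b rewrite dec-false (val x ℤ.≟ val a) x≢a | dec-false (val x ℤ.≟ val b) x≢b
      = refl

s-preserves : (i : Fin n) → Preserves ⁅ i ⁆ (s i)
-- The points -1 and 1 are not adjacent; they are joined through 0.
s-preserves {suc n} zero    a = swap-∼ _ _ a
  (edge⇒∼ (minus {a = neg (hi zero)} {b = 0̂} refl refl) ◅◅ edge⇒∼ (base zero))
s-preserves {suc n} (suc i) a =
  swap-∼ (lo (suc i)) (hi (suc i)) (swap (neg (lo (suc i))) (neg (hi (suc i))) a)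
      (edge⇒∼ (base (suc i)))
  ◅◅ swap-∼ (neg (lo (suc i))) (neg (hi (suc i))) a (∼-sym (edge⇒∼ (Edge-neg (base (suc i)))))

s-lo : (i : Fin n) → toℕ i ≢ 0 → s i ⟨$⟩ lo i ≡ hi i
s-lo {suc n} zero    i≢0 = contradiction refl i≢0
s-lo {suc n} (suc i) i≢0 rewrite dec-true (val (lo (suc i)) ℤ.≟ val (lo (suc i))) refl = refl

s-hi : (i : Fin n) → toℕ i ≢ 0 → s i ⟨$⟩ hi i ≡ lo i
s-hi {suc n} zero    i≢0 = contradiction refl i≢0
s-hi {suc n} (suc i) i≢0
  rewrite dec-false (val (hi (suc i)) ℤ.≟ val (lo (suc i)))
      (λ eq → ℕ.<-irrefl (sym (ℤ.+-injective eq)) (ℕ.n<1+n _))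
        | dec-true (val (hi (suc i)) ℤ.≟ val (hi (suc i))) refl = refl

s-hi₀ : (i : Fin n) → toℕ i ≡ 0 → s i ⟨$⟩ hi i ≡ neg (hi i)
s-hi₀ {suc n} zero _ = refl

s-fixes : (i : Fin n) (b : ℕ) .(p : b ℕ.≤ n) → suc (toℕ i) ℕ.< b → s i ⟨$⟩ pt b p ≡ pt b p
s-fixes {suc n} zero b p 1<b = swap-other (neg (hi zero)) (hi zero) (pt b p) (λ ())
    (λ eq → ℕ.<⇒≢ 1<b (sym (ℤ.+-injective eq)))
s-fixes {suc n} (suc i) b p i<b =
  trans (cong (swap (lo (suc i)) (hi (suc i)))
      (swap-other (neg (lo (suc i))) (neg (hi (suc i))) (pt b p) (λ ()) (λ ())))
        (swap-other (lo (suc i)) (hi (suc i)) (pt b p)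
            (λ eq → ℕ.<⇒≢ (ℕ.<-trans (ℕ.n<1+n _) i<b) (sym (ℤ.+-injective eq)))
                                (λ eq → ℕ.<⇒≢ i<b (sym (ℤ.+-injective eq))))

s-descent : (i : Fin n) → Descent (s i) i
s-descent {suc n} zero    = ⟨ ℤ.-<+ ⟩
s-descent {suc n} (suc i) = subst₂ _≺_ (sym (s-hi (suc i) λ ())) (sym (s-lo (suc i) λ ()))
    (lo≺hi (suc i))

s-decreasing : (i : Fin n) → Decreasing ⁅ i ⁆ (s i)
s-decreasing i = decreasing (s i) (∈-singleton⁻ {P = Descent (s i)} (s-descent i))

s-involutive : (i : Fin n) → s i · s i ≈ ε
s-involutive i = reversals-cancel (s i) (s i) (s-preserves i) (s-decreasing i) (s-preserves i)
    (s-decreasing i)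

-- A reversal of the classes of `⁅ i ⁆` is unique, so conjugates of simple reflections can be
-- identified without computing swaps.
s-unique : (v : W n) → Preserves ⁅ i ⁆ v → Descent v i → v ≈ s i
s-unique {i = i} v p d = reversal-unique v (s i) p (decreasing v (∈-singleton⁻ {P = Descent v} d))
    (s-preserves i) (s-decreasing i)

Flip : Fin n → Rel (X n) 0ℓ
Flip i a b = s i ⟨$⟩ b ≺ s i ⟨$⟩ a

flip⇒∼ : (i : Fin n) → a ≺ b → Flip i a b → a ∼[ ⁅ i ⁆ ] b
flip⇒∼ i a≺b flip = inversion⇒∼ {w = s i} (s-preserves i) a≺b flip

flip? : (i : Fin n) → a ≺ b → s i ⟨$⟩ a ≺ s i ⟨$⟩ b ⊎ Flip i a b
flip? {a = a} {b} i a≺b with cmp (s i ⟨$⟩ a) (s i ⟨$⟩ b)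
... | tri< p _ _ = inj₁ p
... | tri≈ _ p _ = contradiction (subst (_≺ b) (to-injective (s i) p) a≺b) ≺-irrefl
... | tri> _ _ p = inj₂ p

ascent-∼ : (w : W n) → Ascent w i → a ≺ b → a ∼[ ⁅ i ⁆ ] b → w ⟨$⟩ a ≺ w ⟨$⟩ b
ascent-∼ w p = increasing-∼ w (increasing w (∈-singleton⁻ {P = Ascent w} p))

descent-∼ : (w : W n) → Descent w i → a ≺ b → a ∼[ ⁅ i ⁆ ] b → w ⟨$⟩ b ≺ w ⟨$⟩ a
descent-∼ w p = decreasing-∼ w (decreasing w (∈-singleton⁻ {P = Descent w} p))

s-hi∼s-lo : (i : Fin n) → s i ⟨$⟩ hi i ∼[ ⁅ i ⁆ ] s i ⟨$⟩ lo i
s-hi∼s-lo i = s-preserves i (hi i) ◅◅ ∼-sym (edge⇒∼ (base i)) ◅◅ ∼-sym (s-preserves i (lo i))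

ascent⇒descent : (w : W n) → Ascent w i → Descent (w · s i) i
ascent⇒descent {i = i} w p = ascent-∼ w p (s-descent i) (s-hi∼s-lo i)

descent⇒ascent : (w : W n) → Descent w i → Ascent (w · s i) i
descent⇒ascent {i = i} w p = descent-∼ w p (s-descent i) (s-hi∼s-lo i)

Edge-∼ : (u : W n) → Edge j (u ⟨$⟩ lo i) (u ⟨$⟩ hi i) → a ∼[ ⁅ i ⁆ ] b → u ⟨$⟩ a ∼[ ⁅ j ⁆ ] u ⟨$⟩ b
Edge-∼ {j = j} {i = i} u e = ∼-elim (Eq.isEquivalence _) (u ⟨$⟩_) link
  where
  link : ∀ {a b} → Link ⁅ i ⁆ a b → u ⟨$⟩ a ∼[ ⁅ j ⁆ ] u ⟨$⟩ b
  link (i′ , i′∈ , e′) with x∈⁅y⁆⇒x≡y i i′∈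
  link (_ , _ , plus refl refl)  | refl = edge⇒∼ e
  link (_ , _ , minus refl refl) | refl =
    edge⇒∼ (subst₂ (Edge j) (sym (odd u (hi i))) (sym (odd u (lo i))) (Edge-neg e))

-- The conjugate of `s i` by `u` preserves the classes of `⁅ j ⁆`, because `u` carries edges of
-- index `i` to edges of index `j`, and it has a descent at `j`. Hence it is `s j`.
Edge⇒conjugate : (u : W n) → Edge j (u ⟨$⟩ lo i) (u ⟨$⟩ hi i) → u · s i ≈ s j · u
Edge⇒conjugate {n} {j} {i} u e a =
  trans (cong (λ a → u ⟨$⟩ (s i ⟨$⟩ a)) (sym (inverseʳ u a))) (s-unique v′ preserves descent (u ⟨$⟩ a))
  where
  v′ : W n
  v′ = u · s i · u ⁻¹

  preserves : Preserves ⁅ j ⁆ v′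
  preserves b = subst (v′ ⟨$⟩ b ∼[ ⁅ j ⁆ ]_) (inverseˡ u b) (Edge-∼ u e (s-preserves i (u ⁻¹ ⟨$⟩ b)))

  turns : v′ ⟨$⟩ (u ⟨$⟩ hi i) ≺ v′ ⟨$⟩ (u ⟨$⟩ lo i)
  turns = subst₂ (λ a b → u ⟨$⟩ (s i ⟨$⟩ a) ≺ u ⟨$⟩ (s i ⟨$⟩ b)) (sym (inverseʳ u (hi i)))
      (sym (inverseʳ u (lo i)))
            (ascent⇒descent u (Edge⇒≺ e))

  descent : Descent v′ j
  descent = Edge-descent v′ e turns

-- Edges of one index can be concatenated only when they are the two edges at 0.
Edge-next : Edge j a b → Edge j b c → a ≡ neg c × b ≡ 0̂
Edge-next {j = j} (plus refl refl) (plus p _) = contradiction (subst (lo j ≺_) p (lo≺hi j)) ≺-irrefl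
Edge-next (plus refl refl)  (minus p _)    = contradiction p hi≢neghi
  where
  hi≢neghi : hi i ≢ neg (hi j)
  hi≢neghi eq with cong val eq
  ... | ()
Edge-next (minus refl refl) (plus p refl)  = refl , neg-fixed (trans p (sym (neg-involutive (lo _))))
Edge-next {j = j} (minus refl refl) (minus p _) =
  contradiction (subst (_≺ neg (lo j)) (sym p) (neg-≺ (lo≺hi j))) ≺-irrefl

-- A pair flipped by s j is an edge, unless it is (-1, 1).
flip⇒Edge : (j : Fin n) → a ≺ b → Flip j a b → a ≢ neg b → Edge j a b
flip⇒Edge {n} {a} {b} j a≺b flip a≢-b = simplify
    (along {R = TransClosure (Edge j)} (transitive _) single a≺b (flip⇒∼ j a≺b flip)) a≢-b
  where
  single : ∀ {a b} → Link ⁅ j ⁆ a b → TransClosure (Edge j) a b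
  single (i , i∈ , e) = [ subst (λ i → Edge i _ _) (x∈⁅y⁆⇒x≡y j i∈) e ]

  simplify : ∀ {a b} → TransClosure (Edge j) a b → a ≢ neg b → Edge j a b
  simplify [ e ]             a≢-b = e
  simplify (e ∷ [ f ])       a≢-b = contradiction (proj₁ (Edge-next e f)) a≢-b
  -- With a third edge, both ends of the middle one would be 0.
  simplify (e ∷ f ∷ [ g ])   a≢-b = contradiction
      (Edge⇒≺ (subst₂ (Edge j) (proj₂ (Edge-next e f)) (proj₂ (Edge-next f g)) f)) ≺-irrefl
  simplify (e ∷ f ∷ g ∷ _)   a≢-b = contradiction
      (Edge⇒≺ (subst₂ (Edge j) (proj₂ (Edge-next e f)) (proj₂ (Edge-next f g)) f)) ≺-irrefl

-- Length

word-++ : (is js : List (Fin n)) → word (is ++ js) ≈ word is · word js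
word-++ []       js a = refl
word-++ (i ∷ is) js a = cong (s i ⟨$⟩_) (word-++ is js a)

-- The letter to delete is the one that first inverts the images of i and i + 1, reading from the
-- right. Just before it is applied these images form an edge of its index, so the letter can be
-- moved through the remaining word, where it becomes `s i`.
exchange : (is : List (Fin n)) (i : Fin n) → Descent (word is) i →
           ∃[ is′ ] suc (length is′) ≡ length is × word is′ ≈ word is · s i
exchange []       i d = contradiction d (≺-asym (lo≺hi i))
exchange (j ∷ is) i d with ascent? (word is) i
... | inj₂ d′ = let is′ , size , spells = exchange is i d′ in
  j ∷ is′ , cong suc size , λ a → cong (s j ⟨$⟩_) (spells a)
... | inj₁ p = is , refl , λ a → trans (sym (s-involutive j (word is ⟨$⟩ a)))
      (cong (s j ⟨$⟩_) (sym (Edge⇒conjugate (word is) (flip⇒Edge j p d lo≢) a)))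
  where
  -- Excludes the pair (-1, 1), the only one that a simple reflection flips without its being an
  -- edge.
  lo≢ : word is ⟨$⟩ lo i ≢ neg (word is ⟨$⟩ hi i)
  lo≢ eq = lo≢neghi {i = i} {j = i} (to-injective (word is) (trans eq (sym (odd (word is) (hi i)))))

-- Sorting by right multiplication. Once all points above k + 1 are fixed, the preimage of k + 1 is
-- walked to its place one step at a time. A negative preimage is first walked to -1 and then sent
-- to 1 by s₀.
generated : (w : W n) → ∃[ is ] word is ≈ w
generated {n} w = fixing n w ℕ.≤-refl λ i p n<i → contradiction (ℕ.<-≤-trans n<i p) (ℕ.<-irrefl refl)
  where
  FixesAbove : ℕ → W n → Set
  FixesAbove k w = ∀ i (p : i ℕ.≤ n) → k ℕ.< i → w ⟨$⟩ pt i p ≡ pt i p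

  Generated : W n → Set
  Generated w = ∃[ is ] word is ≈ w

  append : ∀ w (i : Fin n) → Generated (w · s i) → Generated w
  append w i (is , spells) = is ++ i ∷ [] , λ a →
    trans (word-++ is (i ∷ []) a) (trans (spells (s i ⟨$⟩ a)) (cong (w ⟨$⟩_) (s-involutive i a)))

  keeps : ∀ k w (i : Fin n) → suc (toℕ i) ℕ.≤ k → FixesAbove k w → FixesAbove k (w · s i)
  keeps k w i i≤k fix b p k<b = trans (cong (w ⟨$⟩_) (s-fixes i b p (ℕ.≤-<-trans i≤k k<b)))
      (fix b p k<b)

  fixing : ∀ k w → k ℕ.≤ n → FixesAbove k w → Generated w

  -- Moves the preimage c of k + 1 up to position k + 1.
  positive : ∀ k w (k<n : suc k ℕ.≤ n) → FixesAbove (suc k) w →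
             ∀ d c .(p : c ℕ.≤ n) → c ℕ.+ d ≡ suc k → w ⟨$⟩ pt c p ≡ pt (suc k) k<n → Generated w
  positive k w k<n fix zero c p c+d≡ wc = fixing k w (ℕ.≤-trans (ℕ.n≤1+n k) k<n) fix′
    where
    fix′ : FixesAbove k w
    fix′ i q k<i with ℕ.m≤n⇒m<n∨m≡n k<i
    ... | inj₁ k+1<i = fix i q k+1<i
    ... | inj₂ refl  = trans (cong (w ⟨$⟩_) (val-injective
        (cong +_ (trans (sym c+d≡) (ℕ.+-identityʳ c))))) wc
  -- The preimage cannot be 0, since 0 is fixed.
  positive k w k<n fix (suc d) zero p c+d≡ wc =
    contradiction (cong val (trans (sym (fixes-0̂ w)) wc)) λ ()
  positive k w k<n fix (suc d) (suc c) p c+d≡ wc =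
    append w t (positive k (w · s t) k<n (keeps k′ w t (ℕ.≤-trans (s≤s (ℕ.≤-reflexive t≡)) c<k+1) fix)
      d (suc (suc c)) c<n (trans (sym (ℕ.+-suc (suc c) d)) c+d≡)
      (trans (cong (w ⟨$⟩_) (trans (cong (s t ⟨$⟩_) (val-injective (cong (+_ ∘ suc) (sym t≡))))
             (trans (s-hi t (λ eq → ℕ.1+n≢0 (trans (sym t≡) eq))) (val-injective (cong +_ t≡))))) wc))
    where
    k′ = suc k
    c<k+1 : suc (suc c) ℕ.≤ suc k
    c<k+1 = ℕ.≤-trans (ℕ.≤-trans (s≤s (s≤s (ℕ.m≤m+n c d)))
        (ℕ.≤-reflexive (cong suc (sym (ℕ.+-suc c d))))) (ℕ.≤-reflexive c+d≡)
    c<n : suc c ℕ.< n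
    c<n = ℕ.≤-trans c<k+1 k<n
    t = fromℕ< c<n
    t≡ = toℕ-fromℕ< c<n

  negative : ∀ k w (k<n : suc k ℕ.≤ n) → FixesAbove (suc k) w →
             ∀ c (p : suc c ℕ.≤ n) → c ℕ.≤ k → w ⟨$⟩ neg (pt (suc c) p) ≡ pt (suc k) k<n → Generated w
  negative k w k<n fix zero p c≤k wc =
    append w t (positive k (w · s t) k<n (keeps (suc k) w t (s≤s (ℕ.≤-trans (ℕ.≤-reflexive t≡) z≤n))
        fix)
      k 1 p refl (trans (cong (w ⟨$⟩_) (trans (cong (s t ⟨$⟩_)
          (val-injective (cong (+_ ∘ suc) (sym t≡))))
        (trans (s-hi₀ t t≡) (cong neg {hi t} {pt 1 p} (val-injective (cong (+_ ∘ suc) t≡)))))) wc))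
    where
    t = fromℕ< p
    t≡ = toℕ-fromℕ< p
  negative k w k<n fix (suc c) p c≤k wc = append w t (negative k (w · s t) k<n
      (keeps (suc k) w t (s≤s (ℕ.≤-trans (ℕ.≤-reflexive t≡) c≤k)) fix)
      c (ℕ.≤-trans (ℕ.n≤1+n _) p) (ℕ.≤-trans (ℕ.n≤1+n _) c≤k)
      (trans (cong (w ⟨$⟩_) (trans (cong (λ a → s t ⟨$⟩ neg a)
          {pt (suc c) (ℕ.≤-trans (ℕ.n≤1+n _) p)} {lo t} (val-injective (cong +_ (sym t≡))))
        (trans (odd (s t) (lo t)) (cong neg {_} {pt (suc (suc c)) p}
            (trans (s-lo t (λ eq → ℕ.1+n≢0 (trans (sym t≡) eq)))
               (val-injective (cong (+_ ∘ suc) t≡))))))) wc))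
    where
    t = fromℕ< p
    t≡ = toℕ-fromℕ< p

  fixing zero w _ fix = [] , λ
    { (mkX (+ zero)    p) → sym (fixes-0̂ w)
    ; (mkX (+ suc i)   p) → sym (fix (suc i) (recompute (_ ℕ.≤? _) p) (s≤s z≤n))
    ; (mkX (-[1+ i ]) p) → sym (trans (odd w (pt (suc i) p))
        (cong neg (fix (suc i) (recompute (_ ℕ.≤? _) p) (s≤s z≤n)))) }
  fixing (suc k) w k<n fix with w ⁻¹ ⟨$⟩ pt (suc k) k<n in eq
  ... | mkX (+ c) p = positive k w k<n fix (suc k ∸ c) c p (ℕ.m+[n∸m]≡n c≤) wc
    where
    wc : w ⟨$⟩ pt c p ≡ pt (suc k) k<n
    wc = trans (cong (w ⟨$⟩_) (sym eq)) (inverseˡ w _)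
    c≤ : c ℕ.≤ suc k
    c≤ = ℕ.≮⇒≥ λ k<c → ℕ.<⇒≢ k<c (sym (ℤ.+-injective
        (cong val (trans (sym (fix c (recompute (_ ℕ.≤? _) p) k<c)) wc))))
  ... | mkX -[1+ c ] p = negative k w k<n fix c p′ c≤ wc
    where
    p′ = recompute (suc c ℕ.≤? n) p
    wc : w ⟨$⟩ neg (pt (suc c) p) ≡ pt (suc k) k<n
    wc = trans (cong (w ⟨$⟩_) (sym eq)) (inverseˡ w _)
    c≤ : c ℕ.≤ k
    c≤ = ℕ.≮⇒≥ λ k<c → contradiction (cong val
        (trans (sym (trans (odd w (pt (suc c) p)) (cong neg (fix (suc c) p′ (s≤s k<c))))) wc)) λ ()

ℓ-resp : v ≈ w → ℓ[ v ]= d → ℓ[ w ]= d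
ℓ-resp v≈w ℓv = record
  { letters = letters ; spells = ≗-trans spells v≈w ; size = size
  ; minimal = λ is p → minimal is (≗-trans p (≗-sym v≈w)) }
  where open ℓ[_]=_ ℓv

ℓ-unique : ℓ[ w ]= d → ℓ[ w ]= e → d ≡ e
ℓ-unique p q = ℕ.≤-antisym (below′ p q) (below′ q p)
  where
  below′ : ∀ {d e} → ℓ[ w ]= d → ℓ[ w ]= e → d ℕ.≤ e
  below′ p q = subst (_ ℕ.≤_) (ℓ[_]=_.size q) (ℓ[_]=_.minimal p (ℓ[_]=_.letters q) (ℓ[_]=_.spells q))

snoc-spells : (w : W n) (is : List (Fin n)) → word is ≈ w → word (is ++ i ∷ []) ≈ w · s i
snoc-spells {i = i} w is p = ≗-trans (word-++ is (i ∷ [])) (λ a → p (s i ⟨$⟩ a))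

length-snoc : (is : List (Fin n)) → length (is ++ i ∷ []) ≡ suc (length is)
length-snoc {i = i} is = trans (length-++ is) (ℕ.+-comm (length is) 1)

descent-shortens : (w : W n) (is : List (Fin n)) → word is ≈ w → Descent w i →
                   ∃[ is′ ] suc (length is′) ≡ length is × word is′ ≈ w · s i
descent-shortens {i = i} w is p d =
  let is′ , size , spells = exchange is i (subst₂ _≺_ (sym (p (hi i))) (sym (p (lo i))) d) in
  is′ , size , ≗-trans spells (λ a → p (s i ⟨$⟩ a))

ℓ-ascent : ℓ[ w ]= d → Ascent w i → ℓ[ w · s i ]= suc d
ℓ-ascent {w = w} {d = d} {i = i} ℓw p = record
  { letters = letters ++ i ∷ [] ; spells = snoc-spells w letters spells
  ; size = trans (length-snoc letters) (cong suc size)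
  ; minimal = λ is q → let is′ , size′ , q′ = descent-shortens (w · s i) is q (ascent⇒descent w p) in
      ℕ.≤-trans (s≤s (minimal is′ (≗-trans q′ (λ a → cong (w ⟨$⟩_) (s-involutive i a)))))
          (ℕ.≤-reflexive size′) }
  where open ℓ[_]=_ ℓw

ℓ-descent : ℓ[ w ]= d → Descent w i → ∃[ e ] ℓ[ w · s i ]= e
ℓ-descent {w = w} {i = i} ℓw p = let is , size′ , q = descent-shortens w letters spells p in
  length is , record
    { letters = is ; spells = q ; size = refl
    ; minimal = λ js r → ℕ.≤-pred (ℕ.≤-trans (ℕ.≤-reflexive (trans size′ size)) (ℕ.≤-trans
        (minimal (js ++ i ∷ []) (≗-trans (snoc-spells (w · s i) js r)
            (λ a → cong (w ⟨$⟩_) (s-involutive i a))))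
        (ℕ.≤-reflexive (length-snoc js)))) }
  where open ℓ[_]=_ ℓw

-- A shortest word is found without a search: starting from the empty word, each further letter
-- turns a shortest word into a shortest word, by appending it at an ascent and by exchange at a
-- descent.
ℓ-exists : (w : W n) → ∃[ d ] ℓ[ w ]= d
ℓ-exists {n} w with generated w
... | is , p = let d , ℓ = extend is ε ℓ-ε in d , ℓ-resp p ℓ
  where
  ℓ-ε : ℓ[ ε ]= 0
  ℓ-ε = record { letters = [] ; spells = λ _ → refl ; size = refl ; minimal = λ _ _ → z≤n }

  extend : (is : List (Fin n)) (w : W n) → ℓ[ w ]= d → ∃[ e ] ℓ[ w · word is ]= e
  extend []       w ℓ = _ , ℓ-resp (λ _ → refl) ℓ
  extend (i ∷ is) w ℓ with ascent? w i
  ... | inj₁ p = let e , ℓ′ = extend is (w · s i) (ℓ-ascent ℓ p) in e , ℓ-resp (λ _ → refl) ℓ′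
  ... | inj₂ p = let e , ℓ′ = extend is (w · s i) (proj₂ (ℓ-descent ℓ p)) in e , ℓ-resp (λ _ → refl) ℓ′

-- Only `len-ℓ` is used of the length; hiding its value keeps the sorting behind it from being
-- unfolded.
abstract
  len : W n → ℕ
  len w = proj₁ (ℓ-exists w)

  len-ℓ : (w : W n) → ℓ[ w ]= len w
  len-ℓ w = proj₂ (ℓ-exists w)

ℓ⇒len : ℓ[ w ]= d → len w ≡ d
ℓ⇒len {w = w} ℓ = ℓ-unique (len-ℓ w) ℓ

len⇒ℓ : len w ≡ d → ℓ[ w ]= d
len⇒ℓ {w = w} refl = len-ℓ w

len-cong : v ≈ w → len v ≡ len w
len-cong {v = v} p = sym (ℓ⇒len (ℓ-resp p (len-ℓ v)))

len-ascent : (w : W n) → Ascent w i → len (w · s i) ≡ suc (len w)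
len-ascent w p = ℓ⇒len (ℓ-ascent (len-ℓ w) p)

len-descent : (w : W n) → Descent w i → len w ≡ suc (len (w · s i))
len-descent {i = i} w p = trans (len-cong (λ a → cong (w ⟨$⟩_) (sym (s-involutive i a))))
                                (len-ascent (w · s i) (descent⇒ascent w p))

len-word : (is : List (Fin n)) → word is ≈ w → len w ℕ.≤ length is
len-word {w = w} is p = ℓ[_]=_.minimal (len-ℓ w) is p

reducedWord : (w : W n) → ∃[ is ] word is ≈ w × length is ≡ len w
reducedWord w = let open ℓ[_]=_ (len-ℓ w) in letters , spells , size

len-ε : len (ε {n}) ≡ 0
len-ε {n} = ℕ.n≤0⇒n≡0 (len-word {w = ε {n}} [] (λ _ → refl))

len-s : (i : Fin n) → len (s i) ≡ 1
len-s i = trans (len-cong (λ _ → refl)) (trans (len-ascent ε (lo≺hi i)) (cong suc len-ε))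

len-·≤ : (x y : W n) → len (x · y) ℕ.≤ len x ℕ.+ len y
len-·≤ x y with reducedWord x | reducedWord y
... | is , p , q | js , p′ , q′ = subst (len (x · y) ℕ.≤_) (trans (length-++ is) (cong₂ ℕ._+_ q q′))
  (len-word (is ++ js) (≗-trans (word-++ is js) (·-cong (word is) x (word js) y p p′)))

-- The last letter of a reduced word is a descent, for at an ascent the word without that letter
-- would be too short. `P` must respect `≈`, because a word spells `w` only pointwise.
descent-induction : (P : W n → Set) → (∀ {v w} → v ≈ w → P v → P w) → P ε →
                    (∀ w i → Descent w i → P (w · s i) → P w) → ∀ w → P w
descent-induction {n} P resp base extend w = go (len w) w refl
  where
  go : ∀ d w → len w ≡ d → P w
  go d w eq with reducedWord w
  ... | is , p , size with initLast is
  go d w eq | .[] , p , size | [] = resp p base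
  go d w eq | .(is ++ i ∷ []) , p , size | is ∷ʳ′ i = shorten d eq
    where
    p′ : word is ≈ w · s i
    p′ a = trans (cong (word is ⟨$⟩_) (sym (s-involutive i a)))
            (trans (sym (word-++ is (i ∷ []) (s i ⟨$⟩ a))) (p (s i ⟨$⟩ a)))
    descent : Descent w i
    descent with ascent? w i
    ... | inj₂ q = q
    ... | inj₁ q = contradiction (ℕ.≤-trans (ℕ.≤-reflexive
        (trans (cong suc (trans (sym (length-snoc {i = i} is)) size)) (sym (len-ascent w q))))
                     (len-word is p′)) (ℕ.<⇒≱ (ℕ.n≤1+n _))
    shorten : ∀ d → len w ≡ d → P w
    shorten zero    eq = contradiction (trans (sym (len-descent w descent)) eq) λ ()
    shorten (suc d) eq = extend w i descent (go d (w · s i)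
        (ℕ.suc-injective (trans (sym (len-descent w descent)) eq)))

-- Additivity of lengths

Additive : W n → W n → Set
Additive x y = ∀ {a b} → a ≺ b → y ⟨$⟩ b ≺ y ⟨$⟩ a → x ⟨$⟩ (y ⟨$⟩ b) ≺ x ⟨$⟩ (y ⟨$⟩ a)

additive-resp : (x x′ y y′ : W n) → x ≈ x′ → y ≈ y′ → Additive x y → Additive x′ y′
additive-resp x x′ y y′ p q add {a} {b} a≺b inv =
  subst₂ _≺_ (eq b) (eq a) (add a≺b (subst₂ _≺_ (sym (q b)) (sym (q a)) inv))
  where
  eq : ∀ a → x ⟨$⟩ (y ⟨$⟩ a) ≡ x′ ⟨$⟩ (y′ ⟨$⟩ a)
  eq = ·-cong x x′ y y′ p q

additive-descent : (x y : W n) → Additive x y → Descent y i → Descent (x · y) i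
additive-descent x y add d = add (lo≺hi _) d

-- If `s i` keeps a pair in order, an inversion there is an inversion of `y` at the moved pair. A
-- pair flipped by `s i` is not inverted by `y · s i`, which has an ascent at `i`.
additive-shorten : (x y : W n) → Additive x y → Descent y i → Additive x (y · s i)
additive-shorten {i = i} x y add d {a} {b} a≺b inv with flip? i a≺b
... | inj₁ p = add p inv
... | inj₂ p = contradiction (ascent-∼ (y · s i) (descent⇒ascent y d) a≺b (flip⇒∼ i a≺b p)) (≺-asym inv)

additive-extend : (x y : W n) → Additive x (y · s i) → Descent (x · y) i → Additive x y
additive-extend {i = i} x y add d {a} {b} a≺b inv with flip? i a≺b
... | inj₁ p = subst₂ (λ a b → x ⟨$⟩ (y ⟨$⟩ b) ≺ x ⟨$⟩ (y ⟨$⟩ a)) (s-involutive i a) (s-involutive i b)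
  (add p (subst₂ (λ a b → y ⟨$⟩ b ≺ y ⟨$⟩ a) (sym (s-involutive i a)) (sym (s-involutive i b)) inv))
... | inj₂ p = descent-∼ (x · y) d a≺b (flip⇒∼ i a≺b p)

additive⇒len : (x y : W n) → Additive x y → len (x · y) ≡ len x ℕ.+ len y
additive⇒len {n} x = descent-induction (λ y → Additive x y → len (x · y) ≡ len x ℕ.+ len y)
  (λ {v} {w} p ih add → trans (len-cong (λ a → cong (x ⟨$⟩_) (sym (p a))))
    (trans (ih (additive-resp x x w v (λ _ → refl) (λ a → sym (p a)) add))
        (cong (len x ℕ.+_) (len-cong p))))
  (λ _ → trans (len-cong (λ _ → refl)) (sym (trans (cong (len x ℕ.+_) len-ε) (ℕ.+-identityʳ (len x)))))
  (λ y i d ih add → trans (len-descent (x · y) (additive-descent x y add d))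
    (trans (cong suc (trans (len-cong (λ _ → refl)) (ih (additive-shorten x y add d))))
    (trans (sym (ℕ.+-suc (len x) (len (y · s i)))) (cong (len x ℕ.+_) (sym (len-descent y d))))))

len⇒additive : (x y : W n) → len (x · y) ≡ len x ℕ.+ len y → Additive x y
len⇒additive {n} x = descent-induction (λ y → len (x · y) ≡ len x ℕ.+ len y → Additive x y)
  (λ {v} {w} p ih eq → additive-resp x x v w (λ _ → refl) p
    (ih (trans (len-cong (λ a → cong (x ⟨$⟩_) (p a)))
        (trans eq (cong (len x ℕ.+_) (len-cong (λ a → sym (p a))))))))
  (λ _ a≺b inv → contradiction inv (≺-asym a≺b))
  extend
  where
  extend : ∀ y i → Descent y i → (len (x · (y · s i)) ≡ len x ℕ.+ len (y · s i) → Additive x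
      (y · s i)) →
         len (x · y) ≡ len x ℕ.+ len y → Additive x y
  extend y i d ih eq with ascent? (x · y) i
  ... | inj₂ d′ = additive-extend x y (ih (ℕ.suc-injective
      (trans (sym (trans (len-descent (x · y) d′) (cong suc (len-cong (λ _ → refl)))))
          (trans eq (trans (cong (len x ℕ.+_) (len-descent y d))
              (ℕ.+-suc (len x) (len (y · s i)))))))) d′
  -- If `x · y` ascended where `y` descends, `x · (y · s i)` would be longer than its two factors
  -- together.
  ... | inj₁ a  = contradiction
          (ℕ.≤-trans (ℕ.≤-reflexive (trans (sym
              (trans eq (trans (cong (len x ℕ.+_) (len-descent y d)) (ℕ.+-suc _ _)))) refl))
            (ℕ.≤-trans (ℕ.n≤1+n _) (ℕ.≤-trans (ℕ.≤-reflexive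
                (trans (sym (len-ascent (x · y) a)) (len-cong (λ _ → refl)))) (len-·≤ x (y · s i)))))
          (ℕ.<⇒≱ ℕ.≤-refl)

-- Bruhat order

ℓ<⇒len : v ℓ< w → len v ℕ.< len w
ℓ<⇒len (_ , _ , p , q , r) = subst₂ ℕ._<_ (sym (ℓ⇒len p)) (sym (ℓ⇒len q)) r

len⇒ℓ< : (v w : W n) → len v ℕ.< len w → v ℓ< w
len⇒ℓ< v w p = len v , len w , len-ℓ v , len-ℓ w , p

≤ᴮ-respˡ : u ≈ v → u ≤ᴮ w → v ≤ᴮ w
≤ᴮ-respˡ p (stop q) = stop (λ a → trans (sym (p a)) (q a))
≤ᴮ-respˡ {u = u} {v = v} p (step {t = t} r (a , b , ℓu , ℓut , a<b) q) =
  step {t = t} r (a , b , ℓ-resp p ℓu , ℓ-resp (λ x → p (t ⟨$⟩ x)) ℓut , a<b)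
      (≤ᴮ-respˡ {u = u · t} (λ x → p (t ⟨$⟩ x)) q)

≤ᴮ-trans : u ≤ᴮ v → v ≤ᴮ w → u ≤ᴮ w
≤ᴮ-trans (stop p)     q = ≤ᴮ-respˡ (λ a → sym (p a)) q
≤ᴮ-trans (step {t = t} r l p) q = step {t = t} r l (≤ᴮ-trans p q)

≤ᴮ⇒len : v ≤ᴮ w → v ≈ w ⊎ len v ℕ.< len w
≤ᴮ⇒len (stop p) = inj₁ p
≤ᴮ⇒len (step r l p) with ≤ᴮ⇒len p
... | inj₁ q = inj₂ (subst (_ ℕ.<_) (len-cong q) (ℓ<⇒len l))
... | inj₂ q = inj₂ (ℕ.<-trans (ℓ<⇒len l) q)

≤ᴮ-antisym : v ≤ᴮ w → w ≤ᴮ v → v ≈ w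
≤ᴮ-antisym p q with ≤ᴮ⇒len p | ≤ᴮ⇒len q
... | inj₁ r | _      = r
... | inj₂ r | inj₁ t = λ a → sym (t a)
... | inj₂ r | inj₂ t = contradiction t (ℕ.<-asym r)

-- Additivity survives the removal of a descent from `y`, so putting the descents back gives an
-- ascending chain from `x` to `x · y` whose reflections are simple; hence the conjugator `ε`.
additive⇒≤ᴮ : (x y : W n) → Additive x y → x ≤ᴮ x · y
additive⇒≤ᴮ {n} x = descent-induction (λ y → Additive x y → x ≤ᴮ x · y)
  (λ {v} {w} p ih add → ≤ᴮ-trans (ih (additive-resp x x w v (λ _ → refl) (λ a → sym (p a)) add))
      (stop (λ a → cong (x ⟨$⟩_) (p a))))
  (λ _ → stop (λ _ → refl))
  (λ y i d ih add → ≤ᴮ-trans (ih (additive-shorten x y add d))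
    (step {t = s i} (ε , i , λ _ → refl)
      (len⇒ℓ< (x · (y · s i)) _ (ℕ.≤-reflexive (trans (cong suc (len-cong (λ _ → refl)))
        (trans (sym (len-descent (x · y) (additive-descent x y add d)))
               (len-cong (λ a → cong (λ b → x ⟨$⟩ (y ⟨$⟩ b)) (sym (s-involutive i a))))))))
      (stop (λ a → cong (λ b → x ⟨$⟩ (y ⟨$⟩ b)) (s-involutive i a)))))

-- Parabolic subgroups

∼-weaken : i ∈ J → a ∼[ ⁅ i ⁆ ] b → a ∼[ J ] b
∼-weaken {i = i} {J = J} i∈J = ∼-elim (Eq.isEquivalence _) (λ a → a)
  λ { (j , j∈ , e) → link⇒∼ (j , subst (_∈ J) (sym (x∈⁅y⁆⇒x≡y i j∈)) i∈J , e) }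

s-preserves-∈ : i ∈ J → Preserves J (s i)
s-preserves-∈ {i = i} i∈J a = ∼-weaken i∈J (s-preserves i a)

∼⇒∈ : (i : Fin n) → lo i ∼[ J ] hi i → i ∈ J
∼⇒∈ {J = J} i lo∼hi with lab-Next J refl {lo i} {hi i} refl (lab-sound J refl lo∼hi)
... | j , j∈J , e = subst (_∈ J) (Edge-index e (base i)) j∈J

member⇒preserves : w ∈⟨ J ⟩ → Preserves J w
member⇒preserves {w = w} {J = J} (is , is⊆J , p) = preserves-resp {v = word is} {w = w} p (go is⊆J)
  where
  go : ∀ {is} → All (_∈ J) is → Preserves J (word is)
  go []                   a = refl*
  go {i ∷ is} (i∈J ∷ rest) = preserves-· {v = s i} {w = word is} (s-preserves-∈ i∈J) (go rest)

-- A descent inverts two consecutive points. If `w` preserves the classes these points are linked,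
-- so every letter stripped from `w` lies in `J`.
parabolicWord : (w : W n) → Preserves J w → ∃[ is ] All (_∈ J) is × word is ≈ w × length is ≡ len w
parabolicWord {n} {J} = descent-induction
  (λ w → Preserves J w → ∃[ is ] All (_∈ J) is × word is ≈ w × length is ≡ len w)
  (λ {v} {w} p ih pw → let is , is⊆J , q , size = ih (preserves-resp {v = w} {w = v} (≗-sym p) pw) in
    is , is⊆J , ≗-trans q p , trans size (len-cong p))
  (λ _ → [] , [] , (λ _ → refl) , sym len-ε)
  λ w i d ih pw →
    let i∈J = ∼⇒∈ i (inversion⇒∼ {w = w} pw (lo≺hi i) d)
        is , is⊆J , q , size = ih (preserves-· {v = w} {w = s i} pw (s-preserves-∈ i∈J)) in
    is ++ i ∷ [] , All.++⁺ is⊆J (i∈J ∷ []) ,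
    ≗-trans (snoc-spells (w · s i) is q) (λ a → cong (w ⟨$⟩_) (s-involutive i a)) ,
    trans (length-snoc is) (trans (cong suc size) (sym (len-descent w d)))

preserves⇒member : (w : W n) → Preserves J w → w ∈⟨ J ⟩
preserves⇒member w pw = let is , is⊆J , q , _ = parabolicWord w pw in is , is⊆J , q

-- Longest elements of parabolic subgroups

Reverses : Subset n → W n → Set
Reverses J w = Preserves J w × Decreasing J w

-- The element -1, which is central and reverses all of X. It bounds every length, and later it
-- turns class reversals into increasing maps.
ω : W n
ω = mkW (mk↔ₛ′ neg neg neg-involutive neg-involutive) (λ _ → refl)

-- Inversions of `b ⁻¹ · w` stay within a class; there `w` reverses and `x` increases, so `x · w`
-- inverts them too. Thus `x · b` lies below `x · w`. With `x = ε` this gives the longest element of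
-- W_J, in general the maximum of a core coset.
additive-reversal : (x b w : W n) → Increasing J x → Preserves J b → Reverses J w → Additive (x · b)
    (b ⁻¹ · w)
additive-reversal x b w inc pb (pw , dw) {a} {a′} a≺a′ inv =
  subst₂ (λ c d → x ⟨$⟩ c ≺ x ⟨$⟩ d) (sym (inverseˡ b (w ⟨$⟩ a′))) (sym (inverseˡ b (w ⟨$⟩ a)))
    (increasing-∼ x inc (decreasing-∼ w dw a≺a′ a∼a′) (pw a′ ◅◅ ∼-sym a∼a′ ◅◅ ∼-sym (pw a)))
  where
  a∼a′ = inversion⇒∼ {w = b ⁻¹ · w} (preserves-· {v = b ⁻¹} {w = w} (preserves-⁻¹ {w = b} pb) pw)
      a≺a′ inv

len≤ω : (w : W n) → len w ℕ.≤ len (ω {n})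
len≤ω {n} w = subst (len w ℕ.≤_) (trans (sym (additive⇒len w (w ⁻¹ · ω) additive))
    (len-cong (λ a → inverseˡ w (neg a))))
  (ℕ.m≤m+n (len w) _)
  where
  additive : Additive w (w ⁻¹ · ω)
  additive {a} {b} a≺b _ = subst₂ _≺_ (sym (inverseˡ w (neg b))) (sym (inverseˡ w (neg a))) (neg-≺ a≺b)

-- Multiply by ascents in `J` until none is left. Each one adds 1 to a length that is at most
-- `len ω`, so `d` bounds the number of remaining steps.
reversal : (J : Subset n) → ∃[ w ] Reverses J w
reversal {n} J = climb (len (ω {n})) ε (ℕ.m≤n+m _ _) (λ _ → refl*)
  where
  ascent-dec : (w : W n) (i : Fin n) → Dec (Ascent w i)
  ascent-dec w i with ascent? w i
  ... | inj₁ p = yes p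
  ... | inj₂ p = no (≺-asym p)

  climb : ∀ d (w : W n) → len (ω {n}) ℕ.≤ len w ℕ.+ d → Preserves J w → ∃[ w ] Reverses J w
  climb d w bound pw with any? (λ i → (i ∈? J) ×-dec ascent-dec w i)
  ... | no none = w , pw , decreasing w descent
    where
    descent : ∀ {j} → j ∈ J → Descent w j
    descent {j} j∈J with ascent? w j
    ... | inj₁ p = contradiction (j , j∈J , p) none
    ... | inj₂ p = p
  climb zero w bound pw | yes (i , i∈J , p) = contradiction
    (ℕ.≤-trans (ℕ.≤-reflexive (sym (len-ascent w p)))
        (ℕ.≤-trans (len≤ω (w · s i)) (ℕ.≤-trans bound (ℕ.≤-reflexive (ℕ.+-identityʳ _)))))
    (ℕ.<⇒≱ ℕ.≤-refl)
  climb (suc d) w bound pw | yes (i , i∈J , p) = climb d (w · s i)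
    (ℕ.≤-trans bound (ℕ.≤-reflexive (trans (ℕ.+-suc (len w) d) (cong (ℕ._+ d) (sym (len-ascent w p))))))
    (preserves-· {v = w} {w = s i} pw (s-preserves-∈ i∈J))

reverses⇒longest : (w : W n) → Reverses J w → IsLongest J w
reverses⇒longest {n} {J} w rw@(pw , dw) = preserves⇒member w pw , below′
  where
  below′ : ∀ x → x ∈⟨ J ⟩ → x ℓ≤ w
  below′ x x∈ = len x , len w , len-ℓ x , len-ℓ w , subst (len x ℕ.≤_)
    (trans (sym (additive⇒len x (x ⁻¹ · w) (additive-reversal ε x w Edge-≺
        (member⇒preserves {w = x} x∈) rw)))
           (len-cong (λ a → inverseˡ x (w ⟨$⟩ a))))
    (ℕ.m≤m+n (len x) _)
    where
    Edge-≺ : Increasing J ε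
    Edge-≺ (_ , _ , e) = Edge⇒≺ e

longest⇒reverses : (w : W n) → IsLongest J w → Reverses J w
longest⇒reverses {n} {J} w (w∈ , max) = pw , decreasing w descent
  where
  pw : Preserves J w
  pw = member⇒preserves {w = w} w∈

  descent : ∀ {j} → j ∈ J → Descent w j
  descent {j} j∈J with ascent? w j
  ... | inj₂ p = p
  ... | inj₁ p with max (w · s j) (preserves⇒member (w · s j)
      (preserves-· {v = w} {w = s j} pw (s-preserves-∈ j∈J)))
  ...   | _ , _ , ℓ₁ , ℓ₂ , le = contradiction
          (ℕ.≤-trans (ℕ.≤-reflexive (trans (sym (len-ascent w p)) (ℓ⇒len ℓ₁)))
              (ℕ.≤-trans le (ℕ.≤-reflexive (sym (ℓ⇒len ℓ₂)))))
          (ℕ.<⇒≱ ℕ.≤-refl)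

-- Block permutations

-- The condition on the inverse makes the image of a class a whole class and not just a part of one.
-- Edges being oriented, the order inside classes is preserved as well.
Block : Subset n → Subset n → W n → Set
Block I J x = (∀ {a b} → Link J a b → Link I (x ⟨$⟩ a) (x ⟨$⟩ b))
            × (∀ {a b} → Link I a b → Link J (x ⁻¹ ⟨$⟩ a) (x ⁻¹ ⟨$⟩ b))

block-· : Block I J x → Block J K y → Block I K (x · y)
block-· (f , f′) (g , g′) = f ∘ g , g′ ∘ f′

block-⁻¹ : Block I J x → Block J I (x ⁻¹)
block-⁻¹ (f , f′) = f′ , f

block-ε : Block J J (ε {n})
block-ε = (λ l → l) , (λ l → l)

block-resp : (x y : W n) → x ≈ y → Block I J x → Block I J y
block-resp {I = I} {J} x y p (f , f′) =
  (λ {a} {b} l → subst₂ (Link I) (p a) (p b) (f l)) ,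
  (λ {a} {b} l → subst₂ (Link J) (⁻¹-cong x y p a) (⁻¹-cong x y p b) (f′ l))

block-increasing : Block I J x → Increasing J x
block-increasing (f , _) l = let _ , _ , e = f l in Edge⇒≺ e

block-∼ : Block I J x → a ∼[ J ] b → x ⟨$⟩ a ∼[ I ] x ⟨$⟩ b
block-∼ {x = x} (f , _) = ∼-elim (Eq.isEquivalence _) (x ⟨$⟩_) (link⇒∼ ∘ f)

block-∼⁻ : Block I J x → x ⟨$⟩ a ∼[ I ] x ⟨$⟩ b → a ∼[ J ] b
block-∼⁻ {I = I} {J = J} {x = x} bx p = subst₂ (_∼[ J ]_) (inverseʳ x _) (inverseʳ x _)
    (block-∼ {x = x ⁻¹} (block-⁻¹ {x = x} bx) p)

Edge-map : (x : W n) → Edge i (x ⟨$⟩ lo j) (x ⟨$⟩ hi j) → Edge j a b → Edge i (x ⟨$⟩ a) (x ⟨$⟩ b)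
Edge-map x e (plus refl refl) = e
Edge-map {i = i} {j} x e (minus refl refl) =
  subst₂ (Edge i) (sym (odd x (hi j))) (sym (odd x (lo j))) (Edge-neg e)

Edge-unmap : (x : W n) → Edge i (x ⟨$⟩ lo j) (x ⟨$⟩ hi j) → Edge j (x ⁻¹ ⟨$⟩ lo i) (x ⁻¹ ⟨$⟩ hi i)
Edge-unmap x (plus p q)  = plus (trans (cong (x ⁻¹ ⟨$⟩_) (sym p)) (inverseʳ x _))
    (trans (cong (x ⁻¹ ⟨$⟩_) (sym q)) (inverseʳ x _))
Edge-unmap {i = i} {j} x (minus p q) =
  minus (flip-sign q) (flip-sign p)
  where
  flip-sign : ∀ {a b} → x ⟨$⟩ a ≡ neg b → x ⁻¹ ⟨$⟩ b ≡ neg a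
  flip-sign {a} {b} eq = to-injective x (trans (inverseˡ x b)
    (trans (sym (neg-involutive b)) (trans (cong neg (sym eq)) (sym (odd x a)))))

-- The relation says that `s i` flips the images of j and j + 1. The ascent puts these images in
-- order, and they cannot be opposite points, so they form an edge of index `i`.
conjugate⇒Edge : (x : W n) → s i ≈ x · s j · x ⁻¹ → Ascent x j → Edge i (x ⟨$⟩ lo j) (x ⟨$⟩ hi j)
conjugate⇒Edge {i = i} {j} x p asc = flip⇒Edge i asc
  (subst₂ _≺_ (sym (moved (hi j))) (sym (moved (lo j))) (ascent⇒descent x asc))
  (λ eq → lo≢neghi {i = j} {j = j} (to-injective x (trans eq (sym (odd x (hi j))))))
  where
  moved : ∀ a → s i ⟨$⟩ (x ⟨$⟩ a) ≡ x ⟨$⟩ (s j ⟨$⟩ a)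
  moved a = trans (p (x ⟨$⟩ a)) (cong (λ b → x ⟨$⟩ (s j ⟨$⟩ b)) (inverseʳ x a))

conjugate⇒block : (x : W n) → J ^ x ≐ I → (∀ {j} → j ∈ J → Ascent x j) → Block I J x
conjugate⇒block {J = J} {I = I} x (to-J , to-I) asc = forth , back
  where
  forth : ∀ {a b} → Link J a b → Link I (x ⟨$⟩ a) (x ⟨$⟩ b)
  forth (j , j∈J , e) = let i , i∈I , p = to-I j∈J in
    i , i∈I , Edge-map x (conjugate⇒Edge x p (asc j∈J)) e

  back : ∀ {a b} → Link I a b → Link J (x ⁻¹ ⟨$⟩ a) (x ⁻¹ ⟨$⟩ b)
  back (i , i∈I , e) = let j , j∈J , p = to-J i∈I in
    j , j∈J , Edge-map (x ⁻¹) (Edge-unmap x (conjugate⇒Edge x p (asc j∈J))) e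

block⇒conjugate : (x : W n) → Block I J x → J ^ x ≐ I
block⇒conjugate {I = I} {J = J} x (f , f′) = to-J , to-I
  where
  to-J : ∀ {i} → i ∈ I → ∃[ j ] j ∈ J × s i ≈ x · s j · x ⁻¹
  to-J {i} i∈I = let j , j∈J , e = f′ (i , i∈I , base i) in
    j , j∈J , λ a → trans (sym (inverseˡ x (s i ⟨$⟩ a))) (cong (x ⟨$⟩_) (Edge⇒conjugate (x ⁻¹) e a))

  to-I : ∀ {j} → j ∈ J → ∃[ i ] i ∈ I × s i ≈ x · s j · x ⁻¹
  to-I {j} j∈J = let i , i∈I , e = f (j , j∈J , base j) in
    i , i∈I , λ a → trans (cong (s i ⟨$⟩_) (sym (inverseˡ x a))) (sym (Edge⇒conjugate x e (x ⁻¹ ⟨$⟩ a)))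

-- The familiar ℓ(x b) = ℓ(x) + ℓ(b) for `x` shortest in x W_J: a pair inverted by `b` stays in one
-- class, where `x` does not change its order.
increasing-additive : (x b : W n) → Increasing J x → Preserves J b → Additive x b
increasing-additive {J = J} x b inc pb {a} {c} a≺c inv =
  increasing-∼ x inc inv (pb c ◅◅ ∼-sym (inversion⇒∼ {w = b} pb a≺c inv) ◅◅ ∼-sym (pb a))

-- Double cosets

∈ᶜ-rep : (p : Coset n) → rep p ∈ᶜ p
∈ᶜ-rep p = ε , ε , ([] , [] , λ _ → refl) , ([] , [] , λ _ → refl) , λ _ → refl

∈ᶜ-resp : (x y : W n) → x ≈ y → x ∈ᶜ p → y ∈ᶜ p
∈ᶜ-resp x y x≈y (a , b , a∈ , b∈ , eq) = a , b , a∈ , b∈ , λ c → trans (sym (x≈y c)) (eq c)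

∈ᶜ-·ʳ : (x b : W n) → Preserves (right p) b → x ∈ᶜ p → x · b ∈ᶜ p
∈ᶜ-·ʳ x b pb (a , b′ , a∈ , b′∈ , eq) = a , b′ · b , a∈ ,
  preserves⇒member (b′ · b) (preserves-· {v = b′} {w = b} (member⇒preserves {w = b′} b′∈) pb) ,
  λ c → eq (b ⟨$⟩ c)

∈ᶜ-·ˡ : (a x : W n) → Preserves (left p) a → x ∈ᶜ p → a · x ∈ᶜ p
∈ᶜ-·ˡ a x pa (a′ , b , a′∈ , b∈ , eq) = a · a′ , b ,
  preserves⇒member (a · a′) (preserves-· {v = a} {w = a′} pa (member⇒preserves {w = a′} a′∈)) , b∈ ,
  λ c → cong (a ⟨$⟩_) (eq c)

rep-∈ : (p : Coset n) (x : W n) → x ∈ᶜ p → rep p ∈ᶜ mkCoset (left p) x (right p)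
rep-∈ p x (a , b , a∈ , b∈ , eq) = a ⁻¹ , b ⁻¹ ,
  preserves⇒member (a ⁻¹) (preserves-⁻¹ {w = a} (member⇒preserves {w = a} a∈)) ,
  preserves⇒member (b ⁻¹) (preserves-⁻¹ {w = b} (member⇒preserves {w = b} b∈)) ,
  λ c → sym (trans (cong (a ⁻¹ ⟨$⟩_) (trans (eq (b ⁻¹ ⟨$⟩ c))
      (cong (λ c → a ⟨$⟩ (rep p ⟨$⟩ c)) (inverseˡ b c))))
                   (inverseʳ a _))

∈ᶜ-trans : (q : Coset n) (x : W n) → x ∈ᶜ mkCoset (left q) y (right q) → y ∈ᶜ q → x ∈ᶜ q
∈ᶜ-trans {y = y} q x (a , b , a∈ , b∈ , eq) y∈ = ∈ᶜ-resp {p = q} (a · y · b) x (≗-sym eq)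
  (∈ᶜ-·ʳ {p = q} (a · y) b (member⇒preserves {w = b} b∈)
      (∈ᶜ-·ˡ {p = q} a y (member⇒preserves {w = a} a∈) y∈))

≈ᶜ-∈ : p ≈ᶜ q → x ∈ᶜ p → x ∈ᶜ q
≈ᶜ-∈ {p = p} {q = q} {x = x} (refl , refl , rep∈) x∈ = ∈ᶜ-trans {y = rep p} q x x∈ rep∈

∈ᶜ⇒≈ᶜ : (p q : Coset n) → left p ≡ left q → right p ≡ right q → (x : W n) → x ∈ᶜ p → x ∈ᶜ q → p ≈ᶜ q
∈ᶜ⇒≈ᶜ p q refl refl x x∈p x∈q = refl , refl , ∈ᶜ-trans {y = x} q (rep p) (rep-∈ p x x∈p) x∈q

≈ᶜ-refl : p ≈ᶜ p
≈ᶜ-refl {p = p} = refl , refl , ∈ᶜ-rep p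

≈ᶜ-sym : p ≈ᶜ q → q ≈ᶜ p
≈ᶜ-sym {p = p} {q = q} eq@(refl , refl , rep∈) = ∈ᶜ⇒≈ᶜ q p refl refl (rep p) rep∈ (∈ᶜ-rep p)

≈ᶜ-trans : p ≈ᶜ q → q ≈ᶜ r → p ≈ᶜ r
≈ᶜ-trans {p = p} {q = q} {r = r} (refl , refl , rep∈) eq′@(refl , refl , _) = refl , refl , ≈ᶜ-∈
    {p = q} {q = r} {x = rep p} eq′ rep∈

≈ᶜ-isEquivalence : IsEquivalence (_≈ᶜ_ {n})
≈ᶜ-isEquivalence = record
  { refl  = λ {p} → ≈ᶜ-refl {p = p}
  ; sym   = λ {p} {q} → ≈ᶜ-sym {p = p} {q = q}
  ; trans = λ {p} {q} {r} → ≈ᶜ-trans {p = p} {q = q} {r = r} }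

-- Such an x is the minimal element of p, and p is a core coset.
record Core (p : Coset n) (x : W n) : Set where
  constructor mkCoreAt
  field
    member : x ∈ᶜ p
    block  : Block (left p) (right p) x
open Core public

-- A core double coset is the one-sided coset x W_J. Elements of the coset agree with `x` up to
-- classes of the left subset once factors from W_J are discarded, and `x` pulls these classes back
-- to those of the right subset.
core-member : (y : W n) → Core p x → y ∈ᶜ p → Preserves (right p) (x ⁻¹ · y)
core-member {p = p} {x = x} y (mkCoreAt (a′ , b′ , a′∈ , b′∈ , x≡) bx) (a , b , a∈ , b∈ , y≡) c =
  block-∼⁻ {x = x} bx (subst (_∼[ left p ] x ⟨$⟩ c) (sym (inverseˡ x (y ⟨$⟩ c))) y∼x)
  where
  c′ = b′ ⁻¹ ⟨$⟩ (b ⟨$⟩ c)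
  y∼x : y ⟨$⟩ c ∼[ left p ] x ⟨$⟩ c
  y∼x = subst (_∼[ left p ] _) (sym (y≡ c)) (member⇒preserves {w = a} a∈ (rep p ⟨$⟩ (b ⟨$⟩ c)))
    ◅◅ ∼-sym (member⇒preserves {w = a′} a′∈ _)
    ◅◅ subst (_∼[ left p ] x ⟨$⟩ c) (trans (x≡ c′)
        (cong (λ c → a′ ⟨$⟩ (rep p ⟨$⟩ c)) (inverseˡ b′ (b ⟨$⟩ c))))
        (block-∼ {x = x} bx (preserves-⁻¹ {w = b′} (member⇒preserves {w = b′} b′∈) (b ⟨$⟩ c) ◅◅
            member⇒preserves {w = b} b∈ c))

core⇒isMin : (p : Coset n) (x : W n) → Core p x → IsMin p x
core⇒isMin p x cx = member cx , λ y y∈ → ≤ᴮ-trans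
  (additive⇒≤ᴮ x (x ⁻¹ · y) (increasing-additive x (x ⁻¹ · y) (block-increasing {x = x} (block cx))
      (core-member {p = p} {x = x} y cx y∈)))
  (stop (λ a → inverseˡ x (y ⟨$⟩ a)))

-- A descent at an index of the right subset would give a shorter element of the same coset, which
-- minimality excludes; so `x` respects the orientation of edges.
isMin⇒core : (p : Coset n) (x : W n) → IsMin p x → right p ^ x ≐ left p → Core p x
isMin⇒core p x (x∈ , min) conj = mkCoreAt x∈ (conjugate⇒block x conj ascent)
  where
  ascent : ∀ {j} → j ∈ right p → Ascent x j
  ascent {j} j∈ with ascent? x j
  ... | inj₁ a = a
  ... | inj₂ d with ≤ᴮ⇒len (min (x · s j) (∈ᶜ-·ʳ {p = p} x (s j) (s-preserves-∈ j∈) x∈))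
  ...   | inj₁ eq = contradiction (ℕ.<-irrefl (sym (len-cong eq))
      (ℕ.≤-reflexive (sym (len-descent x d)))) λ ()
  ...   | inj₂ lt = contradiction lt (ℕ.<-asym (ℕ.≤-reflexive (sym (len-descent x d))))

core⇒isCore : (p : Coset n) (x : W n) → Core p x → IsCore p
core⇒isCore p x cx = x , core⇒isMin p x cx , block⇒conjugate x (block cx)

isCore⇒core : (p : Coset n) (c : IsCore p) → Core p (proj₁ c)
isCore⇒core p (x , min , conj) = isMin⇒core p x min conj

isMin-unique : (p : Coset n) → IsMin p x → IsMin p y → x ≈ y
isMin-unique p (x∈ , x-min) (y∈ , y-min) = ≤ᴮ-antisym (x-min _ y∈) (y-min _ x∈)

core-unique : (p : Coset n) (x y : W n) → Core p x → Core p y → x ≈ y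
core-unique p x y cx cy = isMin-unique p (core⇒isMin p x cx) (core⇒isMin p y cy)

-- Every element of the coset is `x · b` with `b` in the parabolic subgroup, and `additive-reversal`
-- leads from it up to `x · w`.
core⇒isMax : (p : Coset n) (x w : W n) → Core p x → Reverses (right p) w → IsMax p (x · w)
core⇒isMax p x w cx rw = ∈ᶜ-·ʳ {p = p} x w (proj₁ rw) (member cx) , λ y y∈ →
  let b = x ⁻¹ · y in
  ≤ᴮ-trans (≤ᴮ-respˡ {u = x · b} (λ a → inverseˡ x (y ⟨$⟩ a))
    (additive⇒≤ᴮ (x · b) (b ⁻¹ · w) (additive-reversal x b w (block-increasing {x = x} (block cx))
        (core-member {p = p} {x = x} y cx y∈) rw)))
    (stop (λ a → cong (x ⟨$⟩_) (inverseˡ b (w ⟨$⟩ a))))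

isMax-unique : (p : Coset n) → IsMax p x → IsMax p y → x ≈ y
isMax-unique p (x∈ , x-max) (y∈ , y-max) = ≤ᴮ-antisym (y-max _ x∈) (x-max _ y∈)

-- Reduced compositions

star-resp : {is : List (Fin n)} (v w : W n) → v ≈ w → is ⋆ u ↦ v → is ⋆ u ↦ w
star-resp v w p ([] q)       = [] (λ a → trans (q a) (p a))
star-resp v w p (up r l q)   = up r l (λ a → trans (q a) (p a))
star-resp v w p (stay r l q) = stay r l (λ a → trans (q a) (p a))

star-++ : {is js : List (Fin n)} → js ⋆ u ↦ v → is ⋆ v ↦ w → is ++ js ⋆ u ↦ w
star-++ {v = v} {w = w} r ([] p) = star-resp v w p r
star-++ r (up r′ l p)   = up (star-++ r r′) l p
star-++ r (stay r′ l p) = stay (star-++ r r′) l p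

star-up : (is : List (Fin n)) (v : W n) → len (word is · v) ≡ length is ℕ.+ len v → is ⋆ v ↦ word is · v
star-up []       v eq = [] λ _ → refl
star-up {n} (i ∷ is) v eq = up (star-up is v eq′) (len⇒ℓ< (word is · v) (s i · (word is · v))
    (ℕ.≤-reflexive (trans (cong suc eq′) (sym eq″)))) λ _ → refl
  where
  eq″ : len (s i · (word is · v)) ≡ suc (length is ℕ.+ len v)
  eq″ = trans (len-cong (λ _ → refl)) eq
  -- Each letter adds at most 1, so the total leaves no slack for the tail.
  eq′ : len (word is · v) ≡ length is ℕ.+ len v
  eq′ = ℕ.≤-antisym
    (ℕ.≤-trans (len-·≤ (word is) v) (ℕ.+-monoˡ-≤ (len v) (len-word is (λ _ → refl))))
    (ℕ.≤-pred (ℕ.≤-trans (ℕ.≤-reflexive (sym eq″)) (ℕ.≤-trans (len-·≤ (s i) (word is · v))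
      (ℕ.≤-reflexive (cong (ℕ._+ len (word is · v)) (len-s i))))))

star-stay : (is : List (Fin n)) (v : W n) → All (λ i → len (s i · v) ℕ.< len v) is → is ⋆ v ↦ v
star-stay []       v []       = [] λ _ → refl
star-stay (i ∷ is) v (p ∷ ps) = stay (star-stay is v ps) (λ lt → ℕ.<-asym p (ℓ<⇒len lt)) λ _ → refl

module _ {p q r : Coset n} {x y : W n} (comp : IsReducedComposition p q r) (cx : Core q x)
    (cy : Core r y) where

  private
    w₀ = reversal (right r)
    t : W n
    t = proj₁ w₀
    rt = proj₂ w₀

    open IsReducedComposition comp renaming (w to wJ; u to ū)

    rw : Reverses (right q) wJ
    rw = longest⇒reverses wJ longest
    q̄≈ : q̄ ≈ x · wJ
    q̄≈ = isMax-unique q max-q (core⇒isMax q x wJ cx rw)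
    r̄≈ : r̄ ≈ y · t
    r̄≈ = isMax-unique r max-r (core⇒isMax r y t cy rt)
    u≈ : ū ≈ x · y · t
    u≈ a = trans (product a) (trans (q̄≈ _) (cong (x ⟨$⟩_) (trans (inverseˡ wJ _) (r̄≈ a))))

    block-xy : Block (left p) (right p) (x · y)
    block-xy = subst₂ (λ I K → Block I K (x · y)) (sym left≡) (sym right≡)
      (block-· {x = x} {y = y} (block cx) (subst (λ J → Block J (right r) y) (sym composable)
          (block cy)))

    len-xw : len (x · wJ) ≡ len x ℕ.+ len wJ
    len-xw = additive⇒len x wJ (increasing-additive x wJ (block-increasing {x = x} (block cx))
        (proj₁ rw))

  -- The maxima are `x · wJ` and `y · t`, so the prescribed product collapses to `x · y · t`; the
  -- factor `t` can be removed within the coset.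
  composition⇒core : Core p (x · y)
  composition⇒core = mkCoreAt (∈ᶜ-resp {p = p} (ū · t ⁻¹) (x · y)
      (λ a → trans (u≈ (t ⁻¹ ⟨$⟩ a)) (cong (λ a → x ⟨$⟩ (y ⟨$⟩ a)) (inverseˡ t a)))
      (∈ᶜ-·ʳ {p = p} ū (t ⁻¹) (preserves-⁻¹ {w = t}
          (subst (λ K → Preserves K t) (sym right≡) (proj₁ rt))) composite))
    block-xy

  -- Each maximum has the length of its minimal element plus that of a longest element. In the
  -- length condition the longest elements cancel.
  composition⇒additive : Additive x y
  composition⇒additive = len⇒additive x y (cancel lengths)
    where
    open +-*-Solver
    additive : (z : W n) → Increasing (right r) z → len (z · t) ≡ len z ℕ.+ len t
    additive z inc = additive⇒len z t (increasing-additive z t inc (proj₁ rt))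

    cancel : (∃[ a ] ∃[ b ] ∃[ c ] ∃[ d ] ℓ[ ū ]= a × ℓ[ q̄ ]= b × ℓ[ wJ ]= c × ℓ[ r̄ ]= d × a ℕ.+ c
        ≡ b ℕ.+ d) →
             len (x · y) ≡ len x ℕ.+ len y
    cancel (_ , _ , _ , _ , ℓu , ℓq , ℓw , ℓr , eq) =
      ℕ.+-cancelʳ-≡ (len t ℕ.+ len wJ) _ _ (trans
          (solve 3 (λ a b c → a :+ (b :+ c) := a :+ b :+ c) refl (len (x · y)) (len t) (len wJ))
        (trans (cong (ℕ._+ len wJ) (trans (sym
            (additive (x · y) (subst (λ K → Increasing K (x · y)) right≡
            (block-increasing {x = x · y} block-xy)))) (trans (sym (len-cong u≈)) (ℓ⇒len ℓu))))
        (trans (cong (_ ℕ.+_) (ℓ⇒len ℓw)) (trans eq (trans (cong₂ ℕ._+_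
          (trans (sym (ℓ⇒len ℓq)) (trans (len-cong q̄≈) len-xw))
          (trans (sym (ℓ⇒len ℓr)) (trans (len-cong r̄≈)
              (additive y (block-increasing {x = y} (block cy))))))
          (solve 4 (λ a b c d → a :+ b :+ (c :+ d) := a :+ c :+ (d :+ b)) refl (len x) (len wJ)
              (len y) (len t)))))))

composition : {q r : Coset n} {x y : W n} → right q ≡ left r → Core q x → Core r y → Additive x y →
              IsReducedComposition (mkCoset (left q) (x · y) (right r)) q r
composition {n} {q} {r} {x} {y} J≡ cx cy add = record
  { composable = J≡ ; left≡ = refl ; right≡ = refl
  ; q̄ = x · wJ ; r̄ = r̄ ; u = x · r̄ ; w = wJ
  ; max-q = core⇒isMax q x wJ cx rw
  ; max-r = core⇒isMax r y t cy rt
  ; star = star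
  ; composite = ∈ᶜ-·ʳ {p = pq} (x · y) t (proj₁ rt) (∈ᶜ-rep pq)
  ; longest = reverses⇒longest wJ rw
  ; product = λ a → cong (x ⟨$⟩_) (sym (inverseˡ wJ (r̄ ⟨$⟩ a)))
  ; lengths = _ , _ , _ , _ , len-ℓ (x · r̄) , len-ℓ (x · wJ) , len-ℓ wJ , len-ℓ r̄ ,
      trans (cong (ℕ._+ len wJ) (additive⇒len x r̄ add-r̄))
      (trans (solve 3 (λ a b c → a :+ b :+ c := a :+ c :+ b) refl (len x) (len r̄) (len wJ))
             (cong (ℕ._+ len r̄) (sym len-xw)))
  }
  where
  open +-*-Solver
  pq = mkCoset (left q) (x · y) (right r)
  wJ = proj₁ (reversal (right q))
  rw = proj₂ (reversal (right q))
  t = proj₁ (reversal (right r))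
  rt = proj₂ (reversal (right r))
  r̄ = y · t

  block-y : Block (right q) (right r) y
  block-y = subst (λ J → Block J (right r) y) (sym J≡) (block cy)

  len-xw : len (x · wJ) ≡ len x ℕ.+ len wJ
  len-xw = additive⇒len x wJ (increasing-additive x wJ (block-increasing {x = x} (block cx)) (proj₁ rw))

  -- A pair from different classes keeps its order under `t`, so that `add` applies. A pair from one
  -- class is reversed by `t` and kept so by `x · y`.
  add-r̄ : Additive x r̄
  add-r̄ {a} {b} a≺b inv with ∼-or-≁ (right r) a≺b
  ... | inj₂ p   = add (≁-≺ {w = t} (proj₁ rt) p) inv
  ... | inj₁ a∼b = increasing-∼ (x · y) (block-increasing {x = x · y}
      (block-· {x = x} {y = y} (block cx) block-y))
                     (decreasing-∼ t (proj₂ rt) a≺b a∼b) (proj₁ rt b ◅◅ ∼-sym a∼b ◅◅ ∼-sym (proj₁ rt a))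

  -- If `s j` lengthened `r̄`, some pair kept in order by `r̄` would be flipped by `s j`. It would
  -- come from a single class of the right subset, but there `t` reverses and `y` increases.
  descends : ∀ {j} → j ∈ right q → len (s j · r̄) ℕ.< len r̄
  descends {j} j∈J = ℕ.≤-reflexive (sym (trans (len-cong (λ a → sym (s-involutive j (r̄ ⟨$⟩ a))))
    (trans (additive⇒len (s j) (s j · r̄) additive) (cong (ℕ._+ len (s j · r̄)) (len-s j)))))
    where
    additive : Additive (s j) (s j · r̄)
    additive {a} {b} a≺b inv with cmp (r̄ ⟨$⟩ a) (r̄ ⟨$⟩ b)
    ... | tri≈ _ eq _ = contradiction (subst (_≺ b) (to-injective r̄ eq) a≺b) ≺-irrefl
    ... | tri> _ _ p  = subst₂ _≺_ (sym (s-involutive j _)) (sym (s-involutive j _)) p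
    ... | tri< p _ _  = contradiction p (≺-asym
        (increasing-∼ y (block-increasing {x = y} block-y) (decreasing-∼ t (proj₂ rt) a≺b a∼b) tb∼ta))
      where
      ta∼tb : t ⟨$⟩ a ∼[ right r ] t ⟨$⟩ b
      ta∼tb = block-∼⁻ {x = y} block-y (∼-weaken j∈J (flip⇒∼ j p inv))
      tb∼ta = ∼-sym ta∼tb
      a∼b : a ∼[ right r ] b
      a∼b = ∼-sym (proj₁ rt a) ◅◅ ta∼tb ◅◅ proj₁ rt b

  -- The word of `x` is followed by that of `wJ`. The latter acts first and is absorbed by `r̄`;
  -- after that every letter of `x` lengthens the product.
  star : x · wJ * r̄ ↦ x · r̄
  star =
    let is , p , size = reducedWord x
        js , js⊆J , p′ , size′ = parabolicWord wJ (proj₁ rw)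
    in is ++ js , ≗-trans (word-++ is js) (·-cong (word is) x (word js) wJ p p′) ,
       len⇒ℓ (trans len-xw (trans (cong₂ ℕ._+_ (sym size) (sym size′)) (sym (length-++ is)))) ,
       star-++ (star-stay js r̄ (All.map descends js⊆J))
         (star-resp (word is · r̄) (x · r̄) (λ a → p (r̄ ⟨$⟩ a))
           (star-up is r̄ (trans (len-cong (λ a → p (r̄ ⟨$⟩ a)))
               (trans (additive⇒len x r̄ add-r̄) (cong (ℕ._+ len r̄) (sym size))))))

-- Squashing

record Sized (n m : ℕ) : Set where
  constructor sized
  field
    set  : Subset n
    size : ∣ set ∣ ≡ m
open Sized public

label : Sized n m → X n → X (n ∸ m)
label J = lab (set J) (size J)

-- This relation determines `v`, because labels are surjective. Working with it keeps the chosen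
-- representatives `point` out of later arguments.
Induces : (I J : Sized n m) → W n → W (n ∸ m) → Set
Induces I J x v = ∀ a → v ⟨$⟩ label J a ≡ label I (x ⟨$⟩ a)

label-cong : (I J : Sized n m) → set I ≡ set J → ∀ a → label I a ≡ label J a
label-cong (sized _ _) (sized _ _) refl a = refl

point : (J : Sized n m) → X (n ∸ m) → X n
point J c = proj₁ (lab-surjective (set J) (size J) c)

label-point : (J : Sized n m) (c : X (n ∸ m)) → label J (point J c) ≡ c
label-point J c = proj₂ (lab-surjective (set J) (size J) c)

module _ (I J : Sized n m) (x : W n) (bx : Block (set I) (set J) x) where

  private
    to : (I J : Sized n m) (x : W n) → X (n ∸ m) → X (n ∸ m)
    to I J x c = label I (x ⟨$⟩ point J c)

    to-label : (I J : Sized n m) (x : W n) → Block (set I) (set J) x → ∀ a → to I J x (label J a) ≡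
        label I (x ⟨$⟩ a)
    to-label I J x bx a = lab-sound (set I) (size I)
      (block-∼ {x = x} bx (lab-complete (set J) (size J) (label-point J (label J a))))

    inverse : (I J : Sized n m) (x : W n) → Block (set I) (set J) x → ∀ c → to I J x
        (to J I (x ⁻¹) c) ≡ c
    inverse I J x bx c = trans (to-label I J x bx (x ⁻¹ ⟨$⟩ point I c))
      (trans (cong (label I) (inverseˡ x (point I c))) (label-point I c))

    to-odd : ∀ c → to I J x (neg c) ≡ neg (to I J x c)
    to-odd c = trans (cong (λ c → to I J x (neg c)) (sym (label-point J c)))
      (trans (cong (to I J x) (sym (lab-neg (set J) (size J) (point J c))))
      (trans (to-label I J x bx (neg (point J c)))
      (trans (cong (label I) (odd x (point J c))) (lab-neg (set I) (size I) (x ⟨$⟩ point J c)))))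

  squash : W (n ∸ m)
  squash = mkW (mk↔ₛ′ (to I J x) (to J I (x ⁻¹)) (inverse I J x bx)
      (inverse J I (x ⁻¹) (block-⁻¹ {x = x} bx))) to-odd

  squash-induces : Induces I J x squash
  squash-induces = to-label I J x bx

induces-unique : (I J : Sized n m) (x y : W n) (v w : W (n ∸ m)) → x ≈ y → Induces I J x v → Induces
    I J y w → v ≈ w
induces-unique I J x y v w p f g c = trans (cong (v ⟨$⟩_) (sym (label-point J c)))
  (trans (f (point J c)) (trans (cong (label I) (p (point J c)))
  (trans (sym (g (point J c))) (cong (w ⟨$⟩_) (label-point J c)))))

induces-resp : (I J : Sized n m) (x y : W n) (v w : W (n ∸ m)) → x ≈ y → v ≈ w → Induces I J x v →
    Induces I J y w
induces-resp I J x y v w p q f a = trans (sym (q (label J a))) (trans (f a) (cong (label I) (p a)))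

induces-· : (I J K : Sized n m) (x y : W n) (v w : W (n ∸ m)) → Induces I J x v → Induces J K y w →
    Induces I K (x · y) (v · w)
induces-· I J K x y v w f g a = trans (cong (v ⟨$⟩_) (g a)) (f (y ⟨$⟩ a))

induces-⁻¹ : (I J : Sized n m) (x : W n) (v : W (n ∸ m)) → Induces I J x v → Induces J I (x ⁻¹) (v ⁻¹)
induces-⁻¹ I J x v f a = to-injective v (trans (inverseˡ v (label I a))
  (trans (cong (label I) (sym (inverseˡ x a))) (sym (f (x ⁻¹ ⟨$⟩ a)))))

isSquash : (I J : Sized n m) (x : W n) (v : W (n ∸ m)) → Block (set I) (set J) x → Induces I J x v →
           IsSquash (set I) (set J) x v
isSquash {n} I J x v bx f = record
  { labelᴵ = labelling (set I) (size I)
  ; labelᴶ = labelling (set J) (size J)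
  ; into   = λ { c {a} refl → sym (f a) }
  ; onto   = λ c {a} eq → x ⁻¹ ⟨$⟩ a ,
      to-injective v (trans (f (x ⁻¹ ⟨$⟩ a)) (trans (cong (label I) (inverseˡ x a)) eq)) , inverseˡ x a
  ; order  = λ c {a} {b} p q a<b → below (increasing-∼ {a = a} {b = b} x
      (block-increasing {x = x} bx) ⟨ a<b ⟩
      (lab-complete (set J) (size J) (trans p (sym q))))
  }

module _ (I J K : Sized n m) (x y : W n) (v w : W (n ∸ m)) (f : Induces I J x v)
    (g : Induces J K y w) where

  induces-additive : Additive x y → Additive v w
  induces-additive add {c} {d} c≺d inv =
    subst₂ (λ c d → v ⟨$⟩ (w ⟨$⟩ d) ≺ v ⟨$⟩ (w ⟨$⟩ c)) (label-point K c) (label-point K d)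
      (subst₂ _≺_ (sym (fg b₀)) (sym (fg a₀)) (lab-≺ (set I) (size I) (add a≺b inv′) differ))
    where
    a₀ = point K c
    b₀ = point K d
    fg : Induces I K (x · y) (v · w)
    fg = induces-· I J K x y v w f g
    labels : label K a₀ ≺ label K b₀
    labels = subst₂ _≺_ (sym (label-point K c)) (sym (label-point K d)) c≺d
    a≺b : a₀ ≺ b₀
    a≺b = lab-cancel (set K) (size K) labels
    inv′ : y ⟨$⟩ b₀ ≺ y ⟨$⟩ a₀
    inv′ = lab-cancel (set J) (size J) (subst₂ _≺_
        (trans (cong (w ⟨$⟩_) (sym (label-point K d))) (g b₀))
                                                   (trans (cong (w ⟨$⟩_) (sym (label-point K c)))
                                                       (g a₀)) inv)
    -- Order of points gives only weak order of labels; strictness comes from the injectivity of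
    -- `v · w`.
    differ : label I (x ⟨$⟩ (y ⟨$⟩ b₀)) ≢ label I (x ⟨$⟩ (y ⟨$⟩ a₀))
    differ eq = ≺-irrefl (subst (_≺ label K b₀)
        (sym (to-injective (v · w) (trans (fg b₀) (trans eq (sym (fg a₀)))))) labels)

  induces-additive⁻ : Block (set J) (set K) y → Additive v w → Additive x y
  induces-additive⁻ by add {a} {b} a≺b inv with cmp (label K a) (label K b)
  ... | tri≈ _ eq _ = contradiction inv (≺-asym
      (increasing-∼ y (block-increasing {x = y} by) a≺b (lab-complete (set K) (size K) eq)))
  ... | tri> _ _ p  = contradiction a≺b (≺-asym (lab-cancel (set K) (size K) p))
  ... | tri< p _ _  = lab-cancel (set I) (size I) (subst₂ _≺_ (fg b) (fg a) (add p
          (subst₂ _≺_ (sym (g b)) (sym (g a)) (lab-≺ (set J) (size J) inv λ eq →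
             ≺-irrefl (subst (_≺ label K b) (sym
                 (to-injective w (trans (g b) (trans eq (sym (g a)))))) p)))))
    where
    fg : Induces I K (x · y) (v · w)
    fg = induces-· I J K x y v w f g

induces-ε : (I J : Sized n m) (x : W n) (v : W (n ∸ m)) → Block (set I) (set J) x → Induces I J x v
    → v ≈ ε → x ≈ ε
induces-ε {n} I J x v bx f v≈ε = monotone⇒ε x mono
  where
  mono : Monotone x
  mono {a} {b} a≺b with cmp (label J a) (label J b)
  ... | tri≈ _ eq _ = increasing-∼ x (block-increasing {x = x} bx) a≺b
      (lab-complete (set J) (size J) eq)
  ... | tri> _ _ p  = contradiction a≺b (≺-asym (lab-cancel (set J) (size J) p))
  ... | tri< p _ _  = lab-cancel (set I) (size I)
          (subst₂ _≺_ (trans (sym (v≈ε (label J a))) (f a)) (trans (sym (v≈ε (label J b))) (f b)) p)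

block-ε⇒≡ : {I J : Subset n} → Block I J ε → I ≡ J
block-ε⇒≡ {n} (f , f′) = ⊆-antisym (go f′) (go f)
  where
  go : ∀ {I J : Subset n} → (∀ {a b} → Link J a b → Link I a b) → ∀ {j} → j ∈ J → j ∈ I
  go {I = I} f {j} j∈J = let i , i∈I , e = f (j , j∈J , base j) in subst (_∈ I) (Edge-index e (base j)) i∈I

-- The quotient of `x` by `x′` squashes to the identity, so it is trivial. As a trivial block
-- permutation it also identifies the left subsets, which are part of the data of a coset.
induces-injective : (I I′ J : Sized n m) (x x′ : W n) (v v′ : W (n ∸ m)) →
  Block (set I) (set J) x → Block (set I′) (set J) x′ → Induces I J x v → Induces I′ J x′ v′ → v ≈ v′ →
  set I ≡ set I′ × x ≈ x′
induces-injective I I′ J x x′ v v′ bx bx′ f f′ p =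
  block-ε⇒≡ (block-resp z₀ ε z≈ε bz) ,
  λ a → trans (cong (x ⟨$⟩_) (sym (inverseʳ x′ a))) (z≈ε (x′ ⟨$⟩ a))
  where
  z₀ = x · x′ ⁻¹
  bz : Block (set I) (set I′) z₀
  bz = block-· {x = x} {y = x′ ⁻¹} bx (block-⁻¹ {x = x′} bx′)
  z≈ε : z₀ ≈ ε
  z≈ε = induces-ε I I′ z₀ (v · v′ ⁻¹) bz (induces-· I J I′ x (x′ ⁻¹) v (v′ ⁻¹) f
      (induces-⁻¹ I′ J x′ v′ f′))
    (λ c → trans (p (v′ ⁻¹ ⟨$⟩ c)) (inverseˡ v′ c))

subset-injection : (J : Subset n) (I : Subset m) (f : ∀ j → j ∈ J → Fin m) → (∀ j p → f j p ∈ I) →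
                   (∀ j j′ p q → f j p ≡ f j′ q → j ≡ j′) → ∣ J ∣ ℕ.≤ ∣ I ∣
subset-injection []            I f f∈ inj = z≤n
subset-injection (outside ∷ J) I f f∈ inj = subset-injection J I (λ j p → f (suc j) (there p))
    (λ j p → f∈ (suc j) (there p))
  (λ j j′ p q eq → suc-injective (inj _ _ _ _ eq))
subset-injection (inside ∷ J) I f f∈ inj = ℕ.≤-trans
    (s≤s (subset-injection J (I - f zero here) (λ j p → f (suc j) (there p))
  (λ j p → x∈p∧x≢y⇒x∈p-y (f∈ (suc j) (there p)) (λ eq → contradiction (inj _ _ _ _ eq) λ ()))
  (λ j j′ p q eq → suc-injective (inj _ _ _ _ eq)))) (x∈p⇒∣p-x∣<∣p∣ (f∈ zero here))

-- Links carry their index with them, so `x` injects the right subset into the left one, and its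
-- inverse does the opposite. The left subset of a core coset therefore also has `m` elements.
block-size : {I J : Subset n} (x : W n) → Block I J x → ∣ I ∣ ≡ ∣ J ∣
block-size {n} x bx = ℕ.≤-antisym (smaller (x ⁻¹) (block-⁻¹ {x = x} bx)) (smaller x bx)
  where
  smaller : ∀ {I J : Subset n} (x : W n) → Block I J x → ∣ J ∣ ℕ.≤ ∣ I ∣
  smaller {I} {J} x (f , _) = subset-injection J I
    (λ j j∈J → proj₁ (f (j , j∈J , base j))) (λ j j∈J → proj₁ (proj₂ (f (j , j∈J , base j))))
    λ j j′ p q eq → let e  = proj₂ (proj₂ (f (j , p , base j)))
                        e′ = subst (λ i → Edge i _ _) (sym eq) (proj₂ (proj₂ (f (j′ , q , base j′)))) in
      Edge-index (base j) (subst₂ (Edge j′) (inverseʳ x (lo j)) (inverseʳ x (hi j))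
          (Edge-map (x ⁻¹) (Edge-unmap x e′) e))

-- Atomic cosets

Edge⇒Next : Edge j a b → Next a b
Edge⇒Next (plus refl refl)  = refl
Edge⇒Next {j = j} (minus refl refl) = sym (suc-neg (toℕ j))

Next-adjacent : Next a b → a ≺ c → ¬ c ≺ b
Next-adjacent {c = c} eq a≺c c≺b =
  ℤ.<-irrefl refl (ℤ.<-≤-trans (below c≺b) (ℤ.≤-trans (ℤ.≤-reflexive eq) (ℤ.i<j⇒suc[i]≤j (below a≺c))))

-- Both w and ω reverse order, so ω · w is increasing on each class of ∼[ M ].
reversal-block : {M : Subset n} (w : W n) → Reverses M w → Block M M (ω · w)
reversal-block {n} {M} w (pw , dw) =
  (λ l → link-neg (turn l)) ,
  (λ {a} {b} l → subst₂ (Link M) (w≈w⁻¹ (neg a)) (w≈w⁻¹ (neg b)) (turn (link-neg l)))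
  where
  link-neg : ∀ {a b} → Link M a b → Link M (neg b) (neg a)
  link-neg (i , i∈M , e) = i , i∈M , Edge-neg e

  involutive : w · w ≈ ε
  involutive = reversals-cancel w w pw dw pw dw

  w≈w⁻¹ : w ≈ w ⁻¹
  w≈w⁻¹ a = to-injective w (trans (involutive a) (sym (inverseˡ w a)))

  turn : ∀ {a b} → Link M a b → Link M (w ⟨$⟩ b) (w ⟨$⟩ a)
  turn {a} {b} l@(i , i∈M , e) = single (along {R = TransClosure (Link M)} (transitive _) [_] (dw l)
      wb∼wa) wb∼wa
    where
    wb∼wa : w ⟨$⟩ b ∼[ M ] w ⟨$⟩ a
    wb∼wa = pw b ◅◅ ∼-sym (link⇒∼ l) ◅◅ ∼-sym (pw a)
    ascends : ∀ {a b} → TransClosure (Link M) a b → a ≺ b × a ∼[ M ] b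
    ascends [ l@(_ , _ , e) ] = Edge⇒≺ e , link⇒∼ l
    ascends (l@(_ , _ , e) ∷ r) = ≺-trans (Edge⇒≺ e) (proj₁ (ascends r)) , link⇒∼ l ◅◅ proj₂ (ascends r)
    single : TransClosure (Link M) (w ⟨$⟩ b) (w ⟨$⟩ a) → w ⟨$⟩ b ∼[ M ] w ⟨$⟩ a → Link M (w ⟨$⟩ b)
        (w ⟨$⟩ a)
    single [ l ] _ = l
    -- An intermediate point `c` would be sent by `w` strictly between `a` and `b`, which are
    -- consecutive.
    single (_∷_ {y = c} l@(_ , _ , f) r) _ = contradiction
      (subst (w ⟨$⟩ c ≺_) (involutive b) (decreasing-∼ w dw (Edge⇒≺ f) (link⇒∼ l)))
      (Next-adjacent {c = w ⟨$⟩ c} (Edge⇒Next e)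
          (subst (_≺ w ⟨$⟩ c) (involutive a) (decreasing-∼ w dw (proj₁ (ascends r))
          (proj₂ (ascends r)))))

x∈p-y⇒x≢y : {M : Subset n} → i ∈ M - j → i ≢ j
x∈p-y⇒x≢y {j = zero}  {M = inside ∷ M}  () refl
x∈p-y⇒x≢y {j = zero}  {M = outside ∷ M} () refl
x∈p-y⇒x≢y {j = suc j} {M = t ∷ M} (there p) refl = x∈p-y⇒x≢y p refl

block-remove : {M N : Subset n} (x : W n) → Block M N x → Edge i (x ⟨$⟩ lo j) (x ⟨$⟩ hi j) → Block
    (M - i) (N - j) x
block-remove {n} x (f , f′) e = forth x f e , forth (x ⁻¹) f′ (Edge-unmap x e)
  where
  forth : ∀ {i j} {M N : Subset n} (x : W n) → (∀ {a b} → Link N a b → Link M (x ⟨$⟩ a) (x ⟨$⟩ b)) →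
          Edge i (x ⟨$⟩ lo j) (x ⟨$⟩ hi j) → ∀ {a b} → Link (N - j) a b → Link (M - i) (x ⟨$⟩ a)
              (x ⟨$⟩ b)
  forth {i} {j} x f e {a} {b} (k , k∈ , g) with f (k , p─q⊆p _ _ k∈ , g)
  ... | l , l∈M , h = l , x∈p∧x≢y⇒x∈p-y l∈M l≢i , h
    where
    l≢i : l ≢ i
    l≢i refl = x∈p-y⇒x≢y k∈ (Edge-index g (subst₂ (Edge j) (inverseʳ x a) (inverseʳ x b)
        (Edge-map (x ⁻¹) (Edge-unmap x e) h)))

module _ (J : Sized n m) where

  -- An index outside `J` is a jump of `cnt`, and these jumps are numbered by the simple reflections
  -- of W_k; `gap-label` goes the other way.
  label-gap : (τ : Fin n) → τ ∉ set J → ∃[ t ] label J (lo τ) ≡ lo t × label J (hi τ) ≡ hi t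
  label-gap τ τ∉J = fromℕ< bound ,
    val-injective (cong +_ (sym (toℕ-fromℕ< bound))) ,
    val-injective (cong +_ (trans (cnt-∉ τ (set J) τ∉J) (cong suc (sym (toℕ-fromℕ< bound)))))
    where
    bound : cnt (set J) (toℕ τ) ℕ.< n ∸ m
    bound = ℕ.≤-trans (ℕ.≤-reflexive (sym (cnt-∉ τ (set J) τ∉J)))
      (ℕ.≤-trans (cnt-mono (set J) (toℕ<n τ)) (ℕ.≤-reflexive
          (trans (cnt-total (set J)) (cong (n ∸_) (size J)))))

  gap-label : (t : Fin (n ∸ m)) → ∃[ τ ] τ ∉ set J × label J (lo τ) ≡ lo t × label J (hi τ) ≡ hi t
  gap-label t =
    let τ , τ∉J , eq = cnt-jump (set J) (toℕ t)
          (ℕ.≤-trans (toℕ<n t) (ℕ.≤-reflexive (sym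
              (trans (cnt-total (set J)) (cong (n ∸_) (size J)))))) in
    τ , τ∉J , val-injective (cong +_ eq) , val-injective
        (cong +_ (trans (cnt-∉ τ (set J) τ∉J) (cong suc eq)))

-- For a squashing it is known where it inverts, not that it preserves classes. This suffices: any
-- other inversion of `v · s i` would be a pair in one class of `⁅ i ⁆` that `s i` leaves in order.
s-unique′ : (v : W n) → (∀ {a b} → a ≺ b → v ⟨$⟩ b ≺ v ⟨$⟩ a → a ∼[ ⁅ i ⁆ ] b) → Descent v i → v ≈ s i
s-unique′ {n} {i} v inv d a = trans (cong (v ⟨$⟩_) (sym (s-involutive i a)))
    (monotone⇒ε (v · s i) mono (s i ⟨$⟩ a))
  where
  sa∼sb : ∀ {a b} → a ∼[ ⁅ i ⁆ ] b → s i ⟨$⟩ a ∼[ ⁅ i ⁆ ] s i ⟨$⟩ b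
  sa∼sb a∼b = s-preserves i _ ◅◅ a∼b ◅◅ ∼-sym (s-preserves i _)
  mono : Monotone (v · s i)
  mono {a} {b} a≺b with flip? i a≺b
  ... | inj₂ p = descent-∼ v d p (∼-sym (sa∼sb (flip⇒∼ i a≺b p)))
  ... | inj₁ p with cmp (v ⟨$⟩ (s i ⟨$⟩ a)) (v ⟨$⟩ (s i ⟨$⟩ b))
  ...   | tri< q _ _ = q
  ...   | tri≈ _ q _ = contradiction (subst (_≺ b) (to-injective (v · s i) q) a≺b) ≺-irrefl
  ...   | tri> _ _ q = contradiction p (≺-asym (descent-∼ (s i) (s-descent i) a≺b
            (∼-sym (s-preserves i a) ◅◅ inv p q ◅◅ s-preserves i b)))

module _ {M : Subset n} {σ τ : Fin n} (w : W n) (rw : Reverses M w) (σ∈M : σ ∈ M)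
    (τ≈ : s τ ≈ w · s σ · w) where

  private
    involutive : w · w ≈ ε
    involutive = reversals-cancel w w (proj₁ rw) (proj₂ rw) (proj₁ rw) (proj₂ rw)

    wJ = proj₁ (reversal (M - τ))
    rJ = proj₂ (reversal (M - τ))

    -w : W n
    -w = ω · w

    -w-involutive : -w · -w ≈ ε
    -w-involutive a = trans (cong neg (odd w (w ⟨$⟩ a))) (trans (neg-involutive _) (involutive a))

    -w⁻¹ : -w ⁻¹ ≈ -w
    -w⁻¹ a = to-injective -w (trans (inverseˡ -w a) (sym (-w-involutive a)))

    -- The sign is central, so `-w` conjugates `s σ` exactly as `w` does, and unlike `w` it ascends
    -- at σ.
    conjugate : s τ ≈ -w · s σ · -w ⁻¹
    conjugate a = trans (τ≈ a) (sym (trans (cong (λ b → neg (w ⟨$⟩ (s σ ⟨$⟩ b))) (-w⁻¹ a))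
      (trans (cong (λ b → neg (w ⟨$⟩ b)) (odd (s σ) (w ⟨$⟩ a)))
      (trans (cong neg (odd w (s σ ⟨$⟩ (w ⟨$⟩ a)))) (neg-involutive _)))))

    block-w : Block M M -w
    block-w = reversal-block w rw

    edge-τ : Edge τ (-w ⟨$⟩ lo σ) (-w ⟨$⟩ hi σ)
    edge-τ = conjugate⇒Edge -w conjugate (neg-≺ (proj₂ rw (σ , σ∈M , base σ)))

    τ∈M : τ ∈ M
    τ∈M = let j , j∈M , e = proj₁ block-w (σ , σ∈M , base σ) in subst (_∈ M) (Edge-index e edge-τ) j∈M

    edge-σ : Edge σ (-w ⟨$⟩ lo τ) (-w ⟨$⟩ hi τ)
    edge-σ = subst₂ (Edge σ) (-w⁻¹ (lo τ)) (-w⁻¹ (hi τ)) (Edge-unmap -w edge-τ)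

    τ∉J : τ ∉ M - τ
    τ∉J τ∈ = x∈p-y⇒x≢y τ∈ refl

  atomic-min : W n
  atomic-min = w · wJ

  -- Writing the element as `(ω · w) · (ω · wJ)` makes both factors block permutations. The first
  -- one carries the edge of τ to that of σ, so these indices may be deleted from `M`.
  atomic-block : Block (M - σ) (M - τ) atomic-min
  atomic-block = block-resp (-w · (ω · wJ)) (w · wJ)
    (λ a → trans (cong neg (odd w (wJ ⟨$⟩ a))) (neg-involutive _))
    (block-· {x = -w} {y = ω · wJ} (block-remove -w block-w edge-σ) (reversal-block wJ rJ))

  atomic-core : {p : Coset n} → left p ≡ M - σ → right p ≡ M - τ → w ∈ᶜ p → Core p atomic-min
  atomic-core {p} refl refl w∈ = mkCoreAt (∈ᶜ-·ʳ {p = p} w wJ (proj₁ rJ) w∈) atomic-block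

  module _ (sI : ∣ M - σ ∣ ≡ m) (sJ : ∣ M - τ ∣ ≡ m) (v : W (n ∸ m))
      (f : Induces (sized (M - σ) sI) (sized (M - τ) sJ) atomic-min v) where

    private
      I₀ J₀ : Sized n m
      I₀ = sized (M - σ) sI
      J₀ = sized (M - τ) sJ

    module _ (t : Fin (n ∸ m)) (lo-t : label J₀ (lo τ) ≡ lo t) (hi-t : label J₀ (hi τ) ≡ hi t) where

      private
        preserves-M : Preserves M atomic-min
        preserves-M = preserves-· {v = w} {w = wJ} (proj₁ rw)
          λ a → ∼-elim (Eq.isEquivalence _) (λ a → a)
              (λ { (i , i∈ , e) → link⇒∼ (i , p─q⊆p M ⁅ τ ⁆ i∈ , e) }) (proj₁ rJ a)

        collapse : ∀ {a b} → a ∼[ M ] b → label J₀ a ∼[ ⁅ t ⁆ ] label J₀ b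
        collapse = ∼-elim (Eq.isEquivalence _) (label J₀) link
          where
          link : ∀ {a b} → Link M a b → label J₀ a ∼[ ⁅ t ⁆ ] label J₀ b
          link {a} {b} (i , i∈M , e) with i ≟ᶠ τ
          ... | no i≢τ = subst (label J₀ a ∼[ ⁅ t ⁆ ]_)
              (lab-sound (M - τ) sJ (link⇒∼ (i , x∈p∧x≢y⇒x∈p-y i∈M i≢τ , e))) refl*
          link (i , i∈M , plus refl refl) | yes refl = edge⇒∼ (plus lo-t hi-t)
          link (i , i∈M , minus refl refl) | yes refl = edge⇒∼ (minus
            (trans (lab-neg (M - τ) sJ (hi τ)) (cong neg hi-t))
                (trans (lab-neg (M - τ) sJ (lo τ)) (cong neg lo-t)))

        inversions : ∀ {c d} → c ≺ d → v ⟨$⟩ d ≺ v ⟨$⟩ c → c ∼[ ⁅ t ⁆ ] d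
        inversions {c} {d} c≺d inv = subst₂ (_∼[ ⁅ t ⁆ ]_) (label-point J₀ c) (label-point J₀ d)
          (collapse (inversion⇒∼ {w = atomic-min} preserves-M
            (lab-cancel (M - τ) sJ (subst₂ _≺_ (sym (label-point J₀ c)) (sym (label-point J₀ d)) c≺d))
            (lab-cancel (M - σ) sI (subst₂ _≺_ (v-label d) (v-label c) inv))))
          where
          v-label : ∀ c → v ⟨$⟩ c ≡ label I₀ (atomic-min ⟨$⟩ point J₀ c)
          v-label c = trans (cong (v ⟨$⟩_) (sym (label-point J₀ c))) (f (point J₀ c))

        -- The points `lo τ` and `hi τ` have different labels, so `wJ` keeps their order; they lie
        -- in one class of `M`, so `w` then reverses it.
        wJ-≺ : wJ ⟨$⟩ lo τ ≺ wJ ⟨$⟩ hi τ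
        wJ-≺ = lab-cancel (M - τ) sJ (subst₂ _≺_
            (sym (trans (lab-sound (M - τ) sJ (proj₁ rJ (lo τ))) lo-t))
          (sym (trans (lab-sound (M - τ) sJ (proj₁ rJ (hi τ))) hi-t)) (lo≺hi t))

        wJ-∼ : wJ ⟨$⟩ lo τ ∼[ M ] wJ ⟨$⟩ hi τ
        wJ-∼ = weaken (proj₁ rJ (lo τ)) ◅◅ link⇒∼ (τ , τ∈M , base τ) ◅◅ ∼-sym (weaken (proj₁ rJ (hi τ)))
          where
          weaken : ∀ {a b} → a ∼[ M - τ ] b → a ∼[ M ] b
          weaken = ∼-elim (Eq.isEquivalence _) (λ a → a)
              (λ { (i , i∈ , e) → link⇒∼ (i , p─q⊆p M ⁅ τ ⁆ i∈ , e) })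

        descent : Descent v t
        descent = subst₂ (λ c d → v ⟨$⟩ c ≺ v ⟨$⟩ d) hi-t lo-t
            (subst₂ _≺_ (sym (f (hi τ))) (sym (f (lo τ)))
          (lab-≺ (M - σ) sI (decreasing-∼ w (proj₂ rw) wJ-≺ wJ-∼)
            λ eq → ≺-irrefl (subst (_≺ hi t) (trans (sym lo-t)
                (trans (sym (to-injective v (trans (f (hi τ)) (trans eq (sym (f (lo τ))))))) hi-t))
                (lo≺hi t))))

      atomic-induces-at : v ≈ s t
      atomic-induces-at = s-unique′ v inversions descent

    atomic-induces : IsSimple v
    atomic-induces = let t , lo-t , hi-t = label-gap J₀ τ τ∉J in t , atomic-induces-at t lo-t hi-t

∪-remove : (J : Subset n) → i ∉ J → (J ∪ ⁅ i ⁆) - i ≡ J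
∪-remove {i = i} J i∉J = ⊆-antisym forth back
  where
  forth : ∀ {j} → j ∈ (J ∪ ⁅ i ⁆) - i → j ∈ J
  forth j∈ with x∈p∪q⁻ J ⁅ i ⁆ (p─q⊆p _ _ j∈)
  ... | inj₁ j∈J = j∈J
  ... | inj₂ j∈i = contradiction (x∈⁅y⁆⇒x≡y i j∈i) (x∈p-y⇒x≢y j∈)
  back : ∀ {j} → j ∈ J → j ∈ (J ∪ ⁅ i ⁆) - i
  back j∈J = x∈p∧x≢y⇒x∈p-y (x∈p∪q⁺ (inj₁ j∈J)) λ { refl → i∉J j∈J }

-- The definition of an atomic coset starts from σ, but a prescribed right subset prescribes τ. The
-- block permutation `ω · w` sends the edge of τ to an edge, whose index is σ.
reversal-conjugate : {M : Subset n} {τ : Fin n} (w : W n) → Reverses M w → τ ∈ M → ∃[ σ ] σ ∈ M × s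
    τ ≈ w · s σ · w
reversal-conjugate {n} {M} {τ} w rw τ∈M =
  let σ , σ∈M , e = proj₁ (reversal-block w rw) (τ , τ∈M , base τ) in
  σ , σ∈M , λ a → sym (trans (cong (w ⟨$⟩_) (negate (Edge⇒conjugate (ω · w) e a)))
      (involutive (s τ ⟨$⟩ a)))
  where
  involutive : w · w ≈ ε
  involutive = reversals-cancel w w (proj₁ rw) (proj₂ rw) (proj₁ rw) (proj₂ rw)
  negate : ∀ {σ a} → neg (w ⟨$⟩ (s τ ⟨$⟩ a)) ≡ s σ ⟨$⟩ neg (w ⟨$⟩ a) → s σ ⟨$⟩ (w ⟨$⟩ a) ≡ w ⟨$⟩
      (s τ ⟨$⟩ a)
  negate {σ} {a} eq = trans (sym (neg-involutive _))
      (trans (cong neg (trans (sym (odd (s σ) (w ⟨$⟩ a))) (sym eq))) (neg-involutive _))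

≈-isEquivalence : IsEquivalence (_≈_ {n})
≈-isEquivalence = record { refl = λ _ → refl ; sym = ≗-sym ; trans = ≗-trans }

-- The squashing map on core cosets

minimal : CoreCoset n m → W n
minimal p = proj₁ (CoreCoset.isCore p)

minimal-core : (p : CoreCoset n m) → Core (coset p) (minimal p)
minimal-core p = isCore⇒core (coset p) (CoreCoset.isCore p)

rightSet leftSet : CoreCoset n m → Sized n m
rightSet p = sized (right (coset p)) (CoreCoset.size p)
leftSet p  = sized (left (coset p)) (trans (block-size (minimal p) (block (minimal-core p)))
    (CoreCoset.size p))

Sq : CoreCoset n m → W (n ∸ m)
Sq p = squash (leftSet p) (rightSet p) (minimal p) (block (minimal-core p))

Sq-induces : (p : CoreCoset n m) (x : W n) → Core (coset p) x → Induces (leftSet p) (rightSet p) x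
    (Sq p)
Sq-induces p x cx = induces-resp (leftSet p) (rightSet p) (minimal p) x (Sq p) (Sq p)
  (core-unique (coset p) (minimal p) x (minimal-core p) cx) (λ _ → refl)
  (squash-induces (leftSet p) (rightSet p) (minimal p) (block (minimal-core p)))

Sq-unique : (p : CoreCoset n m) (x : W n) (v : W (n ∸ m)) → Core (coset p) x →
            Induces (leftSet p) (rightSet p) x v → Sq p ≈ v
Sq-unique p x v cx = induces-unique (leftSet p) (rightSet p) x x (Sq p) v (λ _ → refl)
    (Sq-induces p x cx)

Sq-isSquashing : IsSquashing {n} {m} Sq
Sq-isSquashing p x x-min = isSquash (leftSet p) (rightSet p) x (Sq p) (block cx) (Sq-induces p x cx)
  where
  cx : Core (coset p) x
  cx = mkCoreAt (proj₁ x-min) (block-resp (minimal p) x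
    (isMin-unique (coset p) (proj₁ (proj₂ (CoreCoset.isCore p))) x-min) (block (minimal-core p)))

Sq-cong : (p q : CoreCoset n m) → coset p ≈ᶜ coset q → Sq p ≈ Sq q
Sq-cong p@(mkCore (mkCoset _ _ _) _ _) q@(mkCore (mkCoset _ _ _) _ _) eq@(refl , refl , _) =
  Sq-unique p (minimal q) (Sq q) (mkCoreAt (≈ᶜ-∈ {p = coset q} {q = coset p} {x = minimal q}
      (≈ᶜ-sym {p = coset p} {q = coset q} eq) (member cx)) (block cx)) (Sq-induces q (minimal q) cx)
  where
  cx = minimal-core q

Sq-injective : (p q : CoreCoset n m) → right (coset p) ≡ right (coset q) → Sq p ≈ Sq q → coset p ≈ᶜ
    coset q
Sq-injective p@(mkCore (mkCoset _ _ _) _ _) q@(mkCore (mkCoset _ _ _) _ _) refl eq =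
  let I≡ , x≈y = induces-injective (leftSet p) (leftSet q) (rightSet p) (minimal p) (minimal q)
          (Sq p) (Sq q)
                   (block (minimal-core p)) (block (minimal-core q))
                   (Sq-induces p (minimal p) (minimal-core p))
                       (Sq-induces q (minimal q) (minimal-core q)) eq in
  ∈ᶜ⇒≈ᶜ (coset p) (coset q) I≡ refl (minimal p) (member (minimal-core p))
    (∈ᶜ-resp {p = coset q} (minimal q) (minimal p) (≗-sym x≈y) (member (minimal-core q)))

-- Obtained from the right-hand version by inverting. Factorisations are compared from their common
-- left end, so the left subsets are the ones known to agree.
Sq-injectiveˡ : (p q : CoreCoset n m) → left (coset p) ≡ left (coset q) → Sq p ≈ Sq q → coset p ≈ᶜ
    coset q
Sq-injectiveˡ p@(mkCore (mkCoset _ _ _) _ _) q@(mkCore (mkCoset _ _ _) _ _) refl eq =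
  let x = minimal p ; y = minimal q ; cx = minimal-core p ; cy = minimal-core q
      J≡ , x≈y = induces-injective (rightSet p) (rightSet q) (leftSet p) (x ⁻¹) (y ⁻¹) (Sq p ⁻¹)
          (Sq q ⁻¹)
                   (block-⁻¹ {x = x} (block cx)) (block-⁻¹ {x = y} (block cy))
                   (induces-⁻¹ (leftSet p) (rightSet p) x (Sq p) (Sq-induces p x cx))
                   (induces-⁻¹ (leftSet q) (rightSet q) y (Sq q) (Sq-induces q y cy))
                   (⁻¹-cong (Sq p) (Sq q) eq) in
  ∈ᶜ⇒≈ᶜ (coset p) (coset q) refl J≡ x (member cx)
    (∈ᶜ-resp {p = coset q} y x (⁻¹-cong (y ⁻¹) (x ⁻¹) (≗-sym x≈y)) (member cy))

Sq-· : (p q r : CoreCoset n m) → right (coset q) ≡ left (coset r) →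
       left (coset p) ≡ left (coset q) → right (coset p) ≡ right (coset r) →
       Core (coset p) (minimal q · minimal r) → Sq p ≈ Sq q · Sq r
Sq-· p@(mkCore (mkCoset _ _ _) _ _) q@(mkCore (mkCoset _ _ _) _ _) r@(mkCore (mkCoset _ _ _) _ _)
    refl refl refl cxy =
  Sq-unique p (minimal q · minimal r) (Sq q · Sq r) cxy
    (induces-· (leftSet q) (rightSet q) (rightSet r) (minimal q) (minimal r) (Sq q) (Sq r)
      (Sq-induces q (minimal q) (minimal-core q)) (Sq-induces r (minimal r) (minimal-core r)))

Sq-additive : (q r : CoreCoset n m) → right (coset q) ≡ left (coset r) →
              Additive (minimal q) (minimal r) → Additive (Sq q) (Sq r)
Sq-additive q@(mkCore (mkCoset _ _ _) _ _) r@(mkCore (mkCoset _ _ _) _ _) refl =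
  induces-additive (leftSet q) (rightSet q) (rightSet r) (minimal q) (minimal r) (Sq q) (Sq r)
    (Sq-induces q (minimal q) (minimal-core q)) (Sq-induces r (minimal r) (minimal-core r))

Sq-additive⁻ : (q r : CoreCoset n m) → right (coset q) ≡ left (coset r) →
               Additive (Sq q) (Sq r) → Additive (minimal q) (minimal r)
Sq-additive⁻ q@(mkCore (mkCoset _ _ _) _ _) r@(mkCore (mkCoset _ _ _) _ _) refl =
  induces-additive⁻ (leftSet q) (rightSet q) (rightSet r) (minimal q) (minimal r) (Sq q) (Sq r)
    (Sq-induces q (minimal q) (minimal-core q)) (Sq-induces r (minimal r) (minimal-core r))
        (block (minimal-core r))

additive⇒lengthsAdd : (x y : W n) → Additive x y → LengthsAdd x y
additive⇒lengthsAdd x y add = len x , len y , len-ℓ x , len-ℓ y , len⇒ℓ (additive⇒len x y add)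

module _ {p : Coset n} (p′ p″ : CoreCoset n m) (comp : IsReducedComposition p (coset p′) (coset p″))
    where

  composition-core : Core p (minimal p′ · minimal p″)
  composition-core = composition⇒core comp (minimal-core p′) (minimal-core p″)

  composition-isCore : IsCore p
  composition-isCore = core⇒isCore p (minimal p′ · minimal p″) composition-core

composition-Sq : (p p′ p″ : CoreCoset n m) → IsReducedComposition (coset p) (coset p′) (coset p″) →
                 Sq p ≈ Sq p′ · Sq p″ × Additive (Sq p′) (Sq p″)
composition-Sq p p′ p″ comp =
  Sq-· p p′ p″ composable left≡ right≡ (composition-core p′ p″ comp) ,
  Sq-additive p′ p″ composable (composition⇒additive comp (minimal-core p′) (minimal-core p″))
  where open IsReducedComposition comp

identityCore : (J : Subset n) → ∣ J ∣ ≡ m → CoreCoset n m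
identityCore J size = mkCore (identity J) (core⇒isCore (identity J) ε
    (mkCoreAt (∈ᶜ-rep (identity J)) block-ε)) size

Sq-identity : (J : Subset n) (size : ∣ J ∣ ≡ m) → Sq (identityCore J size) ≈ ε
Sq-identity J size = Sq-unique (identityCore J size) ε ε (mkCoreAt (∈ᶜ-rep (identity J)) block-ε)
    (λ _ → refl)

-- The coset of the product of the minimal elements, formed whether or not the composition is
-- reduced. Squashing is multiplicative for it in all cases, so arbitrary words in W_k can be
-- lifted.
compose : (q r : CoreCoset n m) → right (coset q) ≡ left (coset r) → CoreCoset n m
compose q r eq = mkCore qr (core⇒isCore qr (minimal q · minimal r) (mkCoreAt (∈ᶜ-rep qr)
    (block-· {x = minimal q} {y = minimal r} (block (minimal-core q))
      (subst (λ J → Block J (right (coset r)) (minimal r)) (sym eq) (block (minimal-core r))))))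
          (CoreCoset.size r)
  where
  qr : Coset _
  qr = mkCoset (left (coset q)) (minimal q · minimal r) (right (coset r))

Sq-compose : (q r : CoreCoset n m) (eq : right (coset q) ≡ left (coset r)) → Sq (compose q r eq) ≈
    Sq q · Sq r
Sq-compose q r eq = Sq-· (compose q r eq) q r eq refl refl
  (mkCoreAt (∈ᶜ-rep (coset (compose q r eq))) (block-· {x = minimal q} {y = minimal r}
      (block (minimal-core q))
      (subst (λ J → Block J (right (coset r)) (minimal r)) (sym eq) (block (minimal-core r)))))

module _ {p : Coset n} (atomic : IsAtomic p) where
  open IsAtomic atomic renaming (w to wM)

  atomic⇒core : Core p (atomic-min wM (longest⇒reverses wM longest) σ∈M τ≈)
  atomic⇒core = atomic-core wM (longest⇒reverses wM longest) σ∈M τ≈ left≡ right≡ w∈p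

atomic⇒isCore : {p : Coset n} → IsAtomic p → IsCore p
atomic⇒isCore {p = p} atomic = core⇒isCore p _ (atomic⇒core atomic)

atomicSq : AtomicCoset n m → W (n ∸ m)
atomicSq a = Sq (toCore atomic⇒isCore a)

atomicSq-simple : (a : AtomicCoset n m) → IsSimple (atomicSq a)
atomicSq-simple a@(mkAtomic (mkCoset _ _ _) atomic@(record { left≡ = refl ; right≡ = refl }) size) =
  atomic-induces wM (longest⇒reverses wM longest) σ∈M τ≈ (Sized.size (leftSet core)) size (Sq core)
    (Sq-induces core _ (atomic⇒core atomic))
  where
  open IsAtomic atomic renaming (w to wM)
  core = toCore atomic⇒isCore a

-- The reflection `s t` exchanges the labels across one gap between classes of `J`. The index τ at
-- that gap is the one to add to `J` to obtain `M`.
simple⇒atomic : (J : Subset n) → ∣ J ∣ ≡ m → (v : W (n ∸ m)) → IsSimple v →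
                Σ[ a ∈ AtomicCoset n m ] right (acoset a) ≡ J × atomicSq a ≈ v
simple⇒atomic {n} {m} J size v (t , v≈) =
  atom , M-τ≡J , λ c → trans
    (atomic-induces-at wM rw σ∈M τ≈ (Sized.size (leftSet core)) size′ (Sq core)
      (Sq-induces core _ (atomic⇒core atomic)) t
      (trans (same (lo τ)) (proj₁ labels)) (trans (same (hi τ)) (proj₂ labels)) c) (sym (v≈ c))
  where
  τ = proj₁ (gap-label (sized J size) t)
  τ∉J = proj₁ (proj₂ (gap-label (sized J size) t))
  labels = proj₂ (proj₂ (gap-label (sized J size) t))
  M = J ∪ ⁅ τ ⁆
  wM = proj₁ (reversal M)
  rw = proj₂ (reversal M)
  conj = reversal-conjugate wM rw (x∈p∪q⁺ {p = J} (inj₂ (x∈⁅x⁆ τ)))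
  σ = proj₁ conj
  σ∈M = proj₁ (proj₂ conj)
  τ≈ = proj₂ (proj₂ conj)
  M-τ≡J = ∪-remove J τ∉J
  size′ : ∣ M - τ ∣ ≡ m
  size′ = trans (cong ∣_∣ M-τ≡J) size
  atomic : IsAtomic (mkCoset (M - σ) wM (M - τ))
  atomic = record { M = M ; σ∈M = σ∈M ; longest = reverses⇒longest wM rw ; τ≈ = τ≈
                  ; left≡ = refl ; right≡ = refl ; w∈p = ∈ᶜ-rep (mkCoset (M - σ) wM (M - τ)) }
  atom = mkAtomic (mkCoset (M - σ) wM (M - τ)) atomic size′
  core = toCore atomic⇒isCore atom
  same : ∀ b → label (sized (M - τ) size′) b ≡ label (sized J size) b
  same = label-cong (sized (M - τ) size′) (sized J size) M-τ≡J

-- Reduced expressions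

∏-cong : {vs ws : List (W n)} → Pointwise _≈_ vs ws → ∏ vs ≈ ∏ ws
∏-cong []                              a = refl
∏-cong (_∷_ {x = v} {y = w} {xs = vs} {ys = ws} p ps) a = ·-cong v w (∏ vs) (∏ ws) p (∏-cong ps) a

len-simple : {v : W n} → IsSimple v → len v ≡ 1
len-simple (i , p) = trans (len-cong p) (len-s i)

len-∏ : {vs : List (W n)} → All IsSimple vs → len (∏ vs) ℕ.≤ length vs
len-∏ {n} [] = ℕ.≤-reflexive (len-ε {n})
len-∏ {vs = v ∷ vs} (p ∷ ps) = ℕ.≤-trans (len-·≤ v (∏ vs))
  (ℕ.≤-trans (ℕ.≤-reflexive (cong (ℕ._+ len (∏ vs)) (len-simple p))) (ℕ.s≤s (len-∏ ps)))

simples : (as : List (AtomicCoset n m)) → All IsSimple (map atomicSq as)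
simples []       = []
simples (a ∷ as) = atomicSq-simple a ∷ simples as

module _ {q : CoreCoset n m} {q′ : Coset n} (a : AtomicCoset n m)
    (comp : IsReducedComposition q′ (coset q) (acoset a)) where

  extend : CoreCoset n m
  extend = mkCore q′ (composition-isCore q (toCore atomic⇒isCore a) comp)
    (trans (cong ∣_∣ (IsReducedComposition.right≡ comp)) (AtomicCoset.size a))

  extend-Sq : Sq extend ≈ Sq q · atomicSq a × Additive (Sq q) (atomicSq a)
  extend-Sq = composition-Sq extend q (toCore atomic⇒isCore a) comp

factorisation-Sq : (q : CoreCoset n m) (as : List (AtomicCoset n m)) (r : CoreCoset n m) →
                   coset q ⟫[ map acoset as ]⇒ coset r →
                   Sq r ≈ Sq q · ∏ (map atomicSq as) × len (Sq r) ≡ len (Sq q) ℕ.+ length as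
factorisation-Sq q [] r (done eq) = r≈q , trans (len-cong r≈q) (sym (ℕ.+-identityʳ _))
  where
  r≈q : Sq r ≈ Sq q
  r≈q = ≗-sym (Sq-cong q r eq)
factorisation-Sq q (a ∷ as) r (step comp rest) =
  (λ c → trans (r≈ c) (q′≈ (∏ (map atomicSq as) ⟨$⟩ c))) ,
  trans len-r (trans (cong (ℕ._+ length as)
    (trans (len-cong q′≈) (trans (additive⇒len (Sq q) (atomicSq a) add)
        (cong (len (Sq q) ℕ.+_) (len-simple (atomicSq-simple a))))))
    (ℕ.+-assoc (len (Sq q)) 1 (length as)))
  where
  ih = factorisation-Sq (extend {q = q} a comp) as r rest
  r≈ = proj₁ ih
  len-r = proj₂ ih
  q′≈ = proj₁ (extend-Sq {q = q} a comp)
  add = proj₂ (extend-Sq {q = q} a comp)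

-- Equal left subsets and equal squashings make the first atoms equal. Hence their right subsets
-- agree, and these are the left subsets of the next atoms.
factorisation-injective : (q q′ : CoreCoset n m) (as bs : List (AtomicCoset n m)) {r r′ : Coset n} →
  right (coset q) ≡ right (coset q′) → coset q ⟫[ map acoset as ]⇒ r → coset q′ ⟫[ map acoset bs ]⇒ r′ →
  Pointwise _≈_ (map atomicSq as) (map atomicSq bs) → Pointwise (_≈ᶜ_ on acoset) as bs
factorisation-injective q q′ []       []       eq f g [] = []
factorisation-injective q q′ (a ∷ as) (b ∷ bs) eq (step comp f) (step comp′ g) (p ∷ ps) =
  a≈b ∷ factorisation-injective (extend {q = q} a comp) (extend {q = q′} b comp′) as bs
          (trans (IsReducedComposition.right≡ comp)
              (trans (proj₁ (proj₂ a≈b)) (sym (IsReducedComposition.right≡ comp′)))) f g ps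
  where
  a≈b : acoset a ≈ᶜ acoset b
  a≈b = Sq-injectiveˡ (toCore atomic⇒isCore a) (toCore atomic⇒isCore b)
    (trans (sym (IsReducedComposition.composable comp))
        (trans eq (IsReducedComposition.composable comp′))) p

-- Lifting words of simple reflections to atomic factorisations

data Chain {n m : ℕ} : Subset n → List (AtomicCoset n m) → Subset n → Set where
  []  : ∀ {J} → Chain J [] J
  _∷_ : ∀ {I a as J} → left (acoset a) ≡ I → Chain (right (acoset a)) as J → Chain I (a ∷ as) J

-- An atom is determined by its squashing and its right subset, so the atoms are found from the last
-- to the first. The left end is an outcome; it is identified only after the composite has been.
chain : (J : Subset n) → ∣ J ∣ ≡ m → {vs : List (W (n ∸ m))} → All IsSimple vs →
        ∃[ I ] Σ[ as ∈ List (AtomicCoset n m) ] ∣ I ∣ ≡ m × Chain I as J × Pointwise _≈_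
            (map atomicSq as) vs
chain J size [] = J , [] , size , [] , []
chain J size {v ∷ vs} (p ∷ ps) =
  let I , as , sI , ch , eqs = chain J size ps
      a , a-right , eq = simple⇒atomic I sI v p in
  left (acoset a) , a ∷ as , Sized.size (leftSet (toCore atomic⇒isCore a)) ,
  refl ∷ subst (λ I → Chain I as J) (sym a-right) ch , eq ∷ eqs

compose-chain : (q : CoreCoset n m) (as : List (AtomicCoset n m)) {J : Subset n} → Chain
    (right (coset q)) as J →
  len (Sq q · ∏ (map atomicSq as)) ≡ len (Sq q) ℕ.+ length as →
  Σ[ r ∈ CoreCoset n m ] right (coset r) ≡ J × left (coset r) ≡ left (coset q) ×
    Sq r ≈ Sq q · ∏ (map atomicSq as) × coset q ⟫[ map acoset as ]⇒ coset r
compose-chain q [] [] eq = q , refl , refl , (λ _ → refl) , done (≈ᶜ-refl {p = coset q})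
compose-chain {n} {m} q (a ∷ as) (a-left ∷ ch) eq =
  let r , r-right , r-left , r≈ , f = compose-chain q′ as ch
        (trans (len-cong (λ c → q′≈ (∏ (map atomicSq as) ⟨$⟩ c))) (trans eq
          (trans (sym (ℕ.+-assoc (len (Sq q)) 1 (length as)))
              (cong (ℕ._+ length as) (sym (trans (len-cong q′≈) len-qa))))))
  in r , r-right , r-left , (λ c → trans (r≈ c) (q′≈ (∏ (map atomicSq as) ⟨$⟩ c))) ,
     step (composition (sym a-left) (minimal-core q) (minimal-core atom)
       (Sq-additive⁻ q atom (sym a-left) (len⇒additive (Sq q) (Sq atom)
         (trans len-qa (cong (len (Sq q) ℕ.+_) (sym (len-simple (atomicSq-simple a)))))))) f
  where
  atom q′ : CoreCoset n m
  atom = toCore atomic⇒isCore a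
  q′   = compose q atom (sym a-left)

  q′≈ : Sq q′ ≈ Sq q · Sq atom
  q′≈ = Sq-compose q atom (sym a-left)

  -- The new atom adds at most 1 to the length and the remaining ones at most `length as`; since the
  -- total is attained, so is each bound.
  len-qa : len (Sq q · Sq atom) ≡ len (Sq q) ℕ.+ 1
  len-qa = ℕ.≤-antisym
    (ℕ.≤-trans (len-·≤ (Sq q) (Sq atom)) (ℕ.≤-reflexive
        (cong (len (Sq q) ℕ.+_) (len-simple (atomicSq-simple a)))))
    (ℕ.+-cancelʳ-≤ (length as) _ _ (ℕ.≤-trans (ℕ.≤-reflexive
        (trans (ℕ.+-assoc (len (Sq q)) 1 (length as))
        (trans (sym eq) (len-cong (λ _ → refl)))))
      (ℕ.≤-trans (len-·≤ (Sq q · Sq atom) (∏ (map atomicSq as)))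
        (ℕ.+-monoʳ-≤ (len (Sq q · Sq atom)) (ℕ.≤-trans (len-∏ (simples as))
            (ℕ.≤-reflexive (length-map atomicSq as)))))))

-- Bijections for cosets, atoms and reduced expressions

Sq-bijective : (J : Subset n) → ∣ J ∣ ≡ m →
  IsBijection {A = Σ[ p ∈ CoreCoset n m ] right (coset p) ≡ J} (_≈ᶜ_ on (coset ∘ proj₁)) _≈_
      (Sq ∘ proj₁)
Sq-bijective {n} {m} J size = record
  { isInjection = record
    { isCongruent = record
      { cong = λ {p} {q} → Sq-cong (proj₁ p) (proj₁ q)
      ; isEquivalence₁ = On.isEquivalence (coset ∘ proj₁) ≈ᶜ-isEquivalence
      ; isEquivalence₂ = ≈-isEquivalence }
    ; injective = λ { {p , refl} {q , eq} → Sq-injective p q (sym eq) } }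
  ; surjective = λ v → let is , spells = generated v ; p , p-right , p≈ = onto is in
      (p , p-right) , λ {z} eq c → trans (Sq-cong (proj₁ z) p eq c) (trans (p≈ c) (spells c)) }
  where
  onto : (is : List (Fin (n ∸ m))) → Σ[ p ∈ CoreCoset n m ] right (coset p) ≡ J × Sq p ≈ word is
  onto [] = identityCore J size , refl , Sq-identity J size
  -- The new atom is placed on the left, so the right subset `J` stays fixed while the left one
  -- varies.
  onto (i ∷ is) =
    let p , p-right , p≈ = onto is
        a , a-right , a≈ = simple⇒atomic (left (coset p)) (Sized.size (leftSet p)) (s i)
            (i , λ _ → refl)
        q = toCore atomic⇒isCore a in
    compose q p a-right , p-right , ≗-trans (Sq-compose q p a-right)
        (·-cong (Sq q) (s i) (Sq p) (word is) a≈ p≈)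

atomicSq-bijective : (J : Subset n) → ∣ J ∣ ≡ m →
  RestrictsToBijection (_≈ᶜ_ on acoset) _≈_ (λ a → right (acoset a) ≡ J) IsSimple
      (Sq ∘ toCore {m = m} (atomic⇒isCore {n}))
atomicSq-bijective {n} {m} J size = (λ {a} _ → atomicSq-simple a) , record
  { isInjection = record
    { isCongruent = record
      { cong = λ {a} {b} → Sq-cong (core a) (core b)
      ; isEquivalence₁ = On.isEquivalence (acoset ∘ proj₁) ≈ᶜ-isEquivalence
      ; isEquivalence₂ = On.isEquivalence proj₁ ≈-isEquivalence }
    ; injective = λ { {a , refl} {b , eq} → Sq-injective (toCore atomic⇒isCore a)
        (toCore atomic⇒isCore b) (sym eq) } }
  ; surjective = λ { (v , v-simple) → let a , a-right , a≈ = simple⇒atomic J size v v-simple in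
      (a , a-right) , λ {z} eq c → trans (Sq-cong (core z) (toCore atomic⇒isCore a) eq c) (a≈ c) } }
  where
  core : (Σ[ a ∈ AtomicCoset n m ] right (acoset a) ≡ J) → CoreCoset n m
  core (a , _) = toCore atomic⇒isCore a

⟫-respʳ : {q r r′ : Coset n} {ps : List (Coset n)} → r ≈ᶜ r′ → q ⟫[ ps ]⇒ r → q ⟫[ ps ]⇒ r′
⟫-respʳ {q = q} {r} {r′} eq (done eq′)     = done (≈ᶜ-trans {p = q} {q = r} {r = r′} eq′ eq)
⟫-respʳ eq (step comp f) = step comp (⟫-respʳ eq f)

factorisation-bijective : (p : CoreCoset n m) →
  RestrictsToBijection (Pointwise (_≈ᶜ_ on acoset)) (Pointwise _≈_)
    (IsReducedFactorisation (coset p) ∘ map acoset) (IsReducedExpression (Sq p))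
        (map (Sq ∘ toCore atomic⇒isCore))
factorisation-bijective {n} {m} p = (λ {as} → lands as) , record
  { isInjection = record
    { isCongruent = record
      { cong = map-cong
      ; isEquivalence₁ = On.isEquivalence proj₁
          (Pointwise.isEquivalence (On.isEquivalence acoset ≈ᶜ-isEquivalence))
      ; isEquivalence₂ = On.isEquivalence proj₁ (Pointwise.isEquivalence ≈-isEquivalence) }
    ; injective = λ { {as , f} {bs , g} → factorisation-injective start start as bs refl f g } }
  ; surjective = λ { (vs , reduced) → let as , f , eqs = onto vs reduced in
      (as , f) , λ eq → Pointwise.transitive ≗-trans (map-cong eq) eqs } }
  where
  start : CoreCoset n m
  start = identityCore (left (coset p)) (Sized.size (leftSet p))

  start≈ε : Sq start ≈ ε
  start≈ε = Sq-identity (left (coset p)) (Sized.size (leftSet p))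

  map-cong : {as bs : List (AtomicCoset n m)} → Pointwise (_≈ᶜ_ on acoset) as bs → Pointwise _≈_
      (map atomicSq as) (map atomicSq bs)
  map-cong [] = []
  map-cong (_∷_ {x = a} {y = b} eq eqs) = Sq-cong (toCore atomic⇒isCore a) (toCore atomic⇒isCore b)
      eq ∷ map-cong eqs

  lands : (as : List (AtomicCoset n m)) → IsReducedFactorisation (coset p) (map acoset as) →
      IsReducedExpression (Sq p) (map atomicSq as)
  lands as f = let p≈ , len-p = factorisation-Sq start as p f in record
    { simple  = simples as
    ; product = λ c → sym (trans (p≈ c) (start≈ε (∏ (map atomicSq as) ⟨$⟩ c)))
    ; reduced = len⇒ℓ (trans len-p (trans (cong (ℕ._+ length as)
        (trans (len-cong start≈ε) (len-ε {n ∸ m}))) (sym (length-map atomicSq as)))) }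

  onto : (vs : List (W (n ∸ m))) → IsReducedExpression (Sq p) vs →
         Σ[ as ∈ List (AtomicCoset n m) ] IsReducedFactorisation (coset p) (map acoset as) ×
             Pointwise _≈_ (map atomicSq as) vs
  onto vs reduced =
    let I , as , sI , ch , eqs = chain (right (coset p)) (CoreCoset.size p) simple
        q = identityCore I sI
        ∏≈ : Sq q · ∏ (map atomicSq as) ≈ Sq p
        ∏≈ c = trans (Sq-identity I sI (∏ (map atomicSq as) ⟨$⟩ c)) (trans (∏-cong eqs c) (product c))
        r , r-right , r-left , r≈ , f = compose-chain q as ch
          (trans (len-cong ∏≈) (trans (ℓ⇒len length-p)
              (trans (trans (sym (Pointwise.Pointwise-length eqs)) (length-map atomicSq as))
            (cong (ℕ._+ length as) (sym (trans (len-cong (Sq-identity I sI)) (len-ε {n ∸ m})))))))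
        -- The right subsets agree by construction and the squashings by the given word; this also
        -- shows that the chain starts at the left subset of `p`.
        r≈p = Sq-injective r p r-right (λ c → trans (r≈ c) (∏≈ c))
    in as , ⟫-respʳ r≈p (subst (λ I → identity I ⟫[ map acoset as ]⇒ coset r)
            (trans (sym r-left) (proj₁ r≈p)) f) , eqs
    where open IsReducedExpression reduced renaming (reduced to length-p)

theorem4p7 : (n m : ℕ) (J : Subset n) → ∣ J ∣ ≡ m →
  Σ[ core ∈ (∀ {p : Coset n} → IsAtomic p → IsCore p) ]
  Σ[ Sq ∈ (CoreCoset n m → W (n ∸ m)) ]
    IsSquashing Sq
    -- (1)
    × ({p : Coset n} (p′ p″ : CoreCoset n m) →
       IsReducedComposition p (coset p′) (coset p″) → IsCore p)
    × ((p p′ p″ : CoreCoset n m) →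
       IsReducedComposition (coset p) (coset p′) (coset p″) →
       Sq p ≈ Sq p′ · Sq p″ × LengthsAdd (Sq p′) (Sq p″))
    -- (2)
    × IsBijection {A = Σ[ p ∈ CoreCoset n m ] right (coset p) ≡ J} (_≈ᶜ_ on (coset ∘ proj₁)) _≈_
        (Sq ∘ proj₁)
    × RestrictsToBijection (_≈ᶜ_ on acoset) _≈_ (λ a → right (acoset a) ≡ J) IsSimple (Sq ∘ toCore core)
    -- (3)
    × ((p : CoreCoset n m) → right (coset p) ≡ J →
       RestrictsToBijection (Pointwise (_≈ᶜ_ on acoset)) (Pointwise _≈_)
         (IsReducedFactorisation (coset p) ∘ map acoset) (IsReducedExpression (Sq p))
         (map (Sq ∘ toCore core)))
theorem4p7 n m J size = atomic⇒isCore , Sq , Sq-isSquashing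
  , composition-isCore
  , (λ p p′ p″ comp → let eq , add = composition-Sq p p′ p″ comp in eq , additive⇒lengthsAdd (Sq p′) (Sq p″) add)
  , Sq-bijective J size
  , atomicSq-bijective J size
  , λ p _ → factorisation-bijective p
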